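{- Let $Q=Q(f,g;B)$ be a non-empty base-flow polyhedron, with $B$ an integral $0$-base-polyhedron, and let $p$ be the unique fully supermodular function with $B=B'(p)$. Let $L\subseteq A$ satisfy $-\infty<f(e)<g(e)<+\infty$ for every $e\in L$. Then the minimum, over all integer-valued $x\in Q$, of the number of edges $e\in L$ with $x(e)=g(e)$ equals $$\max_{\mathcal C}\Big\{\varrho_L(\mathcal C)-\sum_{C\in\mathcal C}\big[\varrho_g(C)-\delta_f(C)-p(C)\big]\Big\},$$ where the maximum is taken over all feasible chains $\mathcal C$ of subsets of $V$. In particular, if the minimum is zero, the maximum is attained at the empty chain.
   Context: $D=(V,A)$ is a finite loopless digraph, $f:A\to\mathbb{Z}\cup\{ -\infty\}$, $g:A\to\mathbb{Z}\cup\{+\infty\}$, $f\le g$. For $x\in\mathbb{R}^V$, $\widetilde x(Z)=\sum_{v\in Z}x(v)$. A base-polyhedron is $B'(p)=\{x:\widetilde x(V)=p(V),\ \widetilde x(Z)\ge p(Z)\ \forall Z\subset V\}$ for $p:2^V\to\mathbb{Z}\cup\{ -\infty\}$ with $p(\emptyset)=0$, $p(V)$ finite and $p(X)+p(Y)\le p(X\cap Y)+p(X\cup Y)$ for all $X,Y$ (this $p$ is uniquely determined by a non-empty $B$, as $p(Z)=\min\{\widetilde x(Z):x\in B\}$); it is a $0$-base-polyhedron if $p(V)=0$, and integral if $p$ is integer-valued where finite. For $x:A\to\mathbb{R}$, $\psi_x(v)=\sum_{uv\in A}x(uv)-\sum_{vu\in A}x(vu)$, and $Q(f,g;B)=\{x\in\mathbb{R}^A:f\le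 x\le g,\ \psi_x\in B\}$. For $C\subseteq V$, $\varrho_g(C)$ is the sum of $g$ over edges entering $C$, $\delta_f(C)$ the sum of $f$ over edges leaving $C$. A chain $\mathcal C$ of subsets of $V$ is feasible if $\sum_{C\in\mathcal C}[\varrho_g(C)-\delta_f(C)-p(C)]<+\infty$. $\varrho_L(\mathcal C)$ denotes the number of edges of $L$ that enter at least one member of $\mathcal C$.
   Formalization: Non-emptiness of Q is assumed in the form that Q contains a rational point rather than a real one; since Q is a polyhedron with integer data, the two are equivalent. -}

module Defs where

open import Data.Bool using (Bool; true; false; _∧_; not; if_then_else_)
open import Data.Nat using (ℕ; suc)
open import Data.Fin using (Fin; _≟_)
open import Data.Fin.Subset using (Subset; Side; inside; outside; _⊂_; _∩_; _∪_; ⊥; ⊤)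
open import Data.Vec using (lookup)
open import Data.List using (List; []; _∷_; foldr; map; filterᵇ; length)
open import Data.Bool.ListAction using (any)
open import Data.List.Relation.Unary.Linked using (Linked)
open import Data.Maybe using (Maybe; just; nothing)
open import Data.Product using (Σ; _×_; ∃)
open import Data.Integer as ℤ using (ℤ; +_)
import Data.Rational as ℚ
open ℚ using (ℚ)
open import Relation.Nullary.Decidable using (⌊_⌋)
open import Relation.Binary.PropositionalEquality using (_≡_; _≢_)

record Digraph : Set where
  field
    n  : ℕ
    m  : ℕ
    tl : Fin m → Fin n
    hd : Fin m → Fin n
    loopless : ∀ e → tl e ≢ hd e
open Digraph public

allFin : (k : ℕ) → List (Fin k)
allFin k = Data.List.tabulate (λ i → i)

isIn : ∀ {k} → Subset k → Fin k → Bool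
isIn S v with lookup S v
... | inside  = true
... | outside = false

-- Extended integers.
-- Lower bounds f : A → ℤ ∪ {-∞} are  Maybe ℤ  with  nothing = -∞.
-- Upper bounds g : A → ℤ ∪ {+∞} are  Maybe ℤ  with  nothing = +∞.
-- p : 2^V → ℤ ∪ {-∞} is  Maybe ℤ  with  nothing = -∞.
-- A sum of values in ℤ ∪ {+∞} (or in ℤ ∪ {-∞}): nothing absorbs.

_⊕_ : Maybe ℤ → Maybe ℤ → Maybe ℤ
just a ⊕ just b = just (a ℤ.+ b)
_      ⊕ _      = nothing

negE : Maybe ℤ → Maybe ℤ
negE (just a) = just (ℤ.- a)
negE nothing  = nothing

sumE : List (Maybe ℤ) → Maybe ℤ
sumE = foldr _⊕_ (just (+ 0))

BoundsOK : (D : Digraph) → (Fin (m D) → Maybe ℤ) → (Fin (m D) → Maybe ℤ) → Set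
BoundsOK D f g = ∀ e a b → f e ≡ just a → g e ≡ just b → a ℤ.≤ b

-- p : 2^V → ℤ ∪ {-∞} with p(∅) = 0, p(V) = 0 (0-base-polyhedron) and
-- fully supermodular: p(X) + p(Y) ≤ p(X∩Y) + p(X∪Y) for all X, Y
-- (trivial when the left side is -∞).

FullySupermodular0 : (k : ℕ) → (Subset k → Maybe ℤ) → Set
FullySupermodular0 k p =
  (p ⊥ ≡ just (+ 0)) × (p ⊤ ≡ just (+ 0)) ×
  (∀ X Y a b → p X ≡ just a → p Y ≡ just b →
     Σ ℤ λ c → Σ ℤ λ d → (p (X ∩ Y) ≡ just c) × (p (X ∪ Y) ≡ just d) ×
       (a ℤ.+ b ℤ.≤ c ℤ.+ d))

sumℚ : List ℚ → ℚ
sumℚ = foldr ℚ._+_ ℚ.0ℚ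

toℚ : ℤ → ℚ
toℚ a = a ℚ./ 1

module _ (D : Digraph) where

  ψ : (Fin (m D) → ℚ) → Fin (n D) → ℚ
  ψ x v = sumℚ (map x (filterᵇ (λ e → ⌊ hd D e ≟ v ⌋) (allFin (m D))))
          ℚ.- sumℚ (map x (filterᵇ (λ e → ⌊ tl D e ≟ v ⌋) (allFin (m D))))

  tildeℚ : (Fin (n D) → ℚ) → Subset (n D) → ℚ
  tildeℚ y Z = sumℚ (map y (filterᵇ (isIn Z) (allFin (n D))))

  InB' : (Subset (n D) → Maybe ℤ) → (Fin (n D) → ℚ) → Set
  InB' p y = (∀ a → p ⊤ ≡ just a → tildeℚ y ⊤ ≡ toℚ a)
           × (∀ Z a → p Z ≡ just a → toℚ a ℚ.≤ tildeℚ y Z)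

  InQ : (Fin (m D) → Maybe ℤ) → (Fin (m D) → Maybe ℤ) →
        (Subset (n D) → Maybe ℤ) → (Fin (m D) → ℚ) → Set
  InQ f g p x = (∀ e a → f e ≡ just a → toℚ a ℚ.≤ x e)
              × (∀ e b → g e ≡ just b → x e ℚ.≤ toℚ b)
              × InB' p (ψ x)

  InQℤ : (Fin (m D) → Maybe ℤ) → (Fin (m D) → Maybe ℤ) →
         (Subset (n D) → Maybe ℤ) → (Fin (m D) → ℤ) → Set
  InQℤ f g p x = InQ f g p (λ e → toℚ (x e))

  enters : Subset (n D) → Fin (m D) → Bool
  enters C e = isIn C (hd D e) ∧ not (isIn C (tl D e))

  leaves : Subset (n D) → Fin (m D) → Bool
  leaves C e = isIn C (tl D e) ∧ not (isIn C (hd D e))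

  -- ϱ_g(C) ∈ ℤ ∪ {+∞}   (nothing = +∞)
  ϱ : (Fin (m D) → Maybe ℤ) → Subset (n D) → Maybe ℤ
  ϱ g C = sumE (map g (filterᵇ (enters C) (allFin (m D))))

  -- δ_f(C) ∈ ℤ ∪ {-∞}   (nothing = -∞)
  δ : (Fin (m D) → Maybe ℤ) → Subset (n D) → Maybe ℤ
  δ f C = sumE (map f (filterᵇ (leaves C) (allFin (m D))))

  -- ϱ_g(C) − δ_f(C) − p(C) ∈ ℤ ∪ {+∞}   (nothing = +∞)
  term : (Fin (m D) → Maybe ℤ) → (Fin (m D) → Maybe ℤ) →
         (Subset (n D) → Maybe ℤ) → Subset (n D) → Maybe ℤ
  term f g p C = ϱ g C ⊕ (negE (δ f C) ⊕ negE (p C))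

  IsChain : List (Subset (n D)) → Set
  IsChain 𝒞 = Linked _⊂_ 𝒞

  -- Σ_{C∈𝒞} [ϱ_g(C) − δ_f(C) − p(C)] ∈ ℤ ∪ {+∞}; the chain is feasible
  -- iff this is finite (just k)
  chainSum : (Fin (m D) → Maybe ℤ) → (Fin (m D) → Maybe ℤ) →
             (Subset (n D) → Maybe ℤ) → List (Subset (n D)) → Maybe ℤ
  chainSum f g p 𝒞 = sumE (map (term f g p) 𝒞)

  Feasible : (Fin (m D) → Maybe ℤ) → (Fin (m D) → Maybe ℤ) →
             (Subset (n D) → Maybe ℤ) → List (Subset (n D)) → Set
  Feasible f g p 𝒞 = ∃ λ k → chainSum f g p 𝒞 ≡ just k

  ϱL : Subset (m D) → List (Subset (n D)) → ℕ
  ϱL L 𝒞 = length (filterᵇ (λ e → isIn L e ∧ any (λ C → enters C e) 𝒞)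
                           (allFin (m D)))

  -- objective value of a chain: ϱ_L(𝒞) − Σ[...]  (nothing = -∞ if infeasible)
  chainValue : (Fin (m D) → Maybe ℤ) → (Fin (m D) → Maybe ℤ) →
               (Subset (n D) → Maybe ℤ) → Subset (m D) →
               List (Subset (n D)) → Maybe ℤ
  chainValue f g p L 𝒞 with chainSum f g p 𝒞
  ... | just k  = just (+ ϱL L 𝒞 ℤ.- k)
  ... | nothing = nothing

  atUpper : (Fin (m D) → Maybe ℤ) → (Fin (m D) → ℤ) → Fin (m D) → Bool
  atUpper g x e with g e
  ... | just b  = ⌊ x e ℤ.≟ b ⌋
  ... | nothing = false

  countUpper : (Fin (m D) → Maybe ℤ) → Subset (m D) → (Fin (m D) → ℤ) → ℕ
  countUpper g L x = length (filterᵇ (λ e → isIn L e ∧ atUpper g x e)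
                                     (allFin (m D)))

  GoodL : (Fin (m D) → Maybe ℤ) → (Fin (m D) → Maybe ℤ) → Subset (m D) → Set
  GoodL f g L = ∀ e → isIn L e ≡ true →
    Σ ℤ λ a → Σ ℤ λ b → (f e ≡ just a) × (g e ≡ just b) × (a ℤ.< b)

{-# OPTIONS --safe #-}
-- Put h(C) = p(C) + δ_f(C) − ϱ_g(C) + ϱ_L(C), a supermodular function because f ≤ g − χ_L.
-- An integral x ∈ Q meeting the upper bound at most on Z ⊆ L exists iff Z covers h, that is
-- ϱ_Z ≥ h (rounding lemma `realize`), so the minimum is the least size of a cover Z ⊆ L of h.
-- The matching dual family is found by induction on L.  For e ∈ L, the dual optima with e
-- deleted and with e contracted (h replaced by h − ϱ_e) are families of sets; if neither is
-- optimal for L, they lie on different sides of e's breakpoint, and since uncrossing their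
-- union and distributing the members of the resulting chain alternately into two families
-- does not decrease the dual objective, bisection yields an optimal family.
module Submission where

open import Defs
open import Data.Fin using (Fin)
open import Data.Fin.Subset using (Subset)
open import Data.List using (List; [])
open import Data.Maybe using (Maybe; just)
open import Data.Product using (Σ; _×_; ∃)
open import Data.Integer using (ℤ; +_; _≤_)
open import Data.Rational using (ℚ)
open import Relation.Binary.PropositionalEquality using (_≡_)

open import Algebra.Bundles using (module AbelianGroup)
open import Algebra.Properties.CommutativeSemigroup using (interchange)
open import Data.Bool using (Bool; true; false; _∧_; _∨_; not; if_then_else_)
open import Data.Bool.ListAction using (any)
import Data.Fin as Fin
open import Data.Fin.Subset using (_⊆_; _⊂_; _∩_; _∪_; _∈_; ⊤)
open import Data.Fin.Subset.Properties
  using (anySubset?; _∈?_; _⊂?_; ⊆-trans; ⊆-antisym; ⊂-⊆-trans; p∩q⊆p; p⊆p∪q; x∈p∩q⁺)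
open import Data.Integer as ℤ
  using (-[1+_]; -≤+; +≤+; 0ℤ; 1ℤ; _+_; _-_; -_; _*_; _<_; _≤?_; _≟_; _⊔_; ∣_∣)
open import Data.Integer.DivMod using (_/ℕ_; [n/ℕd]*d≤n; n<s[n/ℕd]*d)
open import Data.Integer.Properties hiding (_≤?_; _≟_)
open import Data.Integer.Tactic.RingSolver using (solve; solve-∀)
open import Data.List using (_∷_; length; replicate; foldr; _++_; map; filterᵇ; tabulate)
open import Data.List.Properties using (length-tabulate; length-filter)
open import Data.List.Relation.Binary.Sublist.Propositional
  using (_∷ʳ_) renaming (_⊆_ to _⊑_; [] to []ₛ; _∷_ to _∷ₛ_)
open import Data.List.Relation.Unary.All as All using (All) renaming ([] to []ₐ; _∷_ to _∷ₐ_)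
open import Data.List.Relation.Unary.All.Properties using (replicate⁺; ++⁺)
open import Data.List.Relation.Unary.AllPairs using (AllPairs) renaming ([] to []ₚ; _∷_ to _∷ₚ_)
open import Data.List.Relation.Unary.Linked.Properties using (AllPairs⇒Linked)
open import Data.Maybe using (nothing; fromMaybe)
open import Data.Maybe.Properties using (just-injective)
open import Data.Nat as ℕ using (ℕ; zero; suc; z≤n; s≤s)
import Data.Nat.Properties as ℕ
open import Data.Product using (_,_; proj₁; proj₂)
open import Data.Rational as ℚ using (0ℚ; ↥_; ↧ₙ_; toℚᵘ)
import Data.Rational.Properties as ℚ
import Data.Rational.Unnormalised as ℚᵘ
import Data.Rational.Unnormalised.Properties as ℚᵘ
open import Data.Sum using (_⊎_; inj₁; inj₂)
open import Data.Vec using (lookup)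
open import Data.Vec.Properties using (lookup-zipWith; lookup-replicate; []=⇒lookup; lookup⇒[]=)
open import Function using (_∘_; id)
open import Relation.Binary.PropositionalEquality
open import Relation.Nullary using (¬_; Dec; yes; no; contradiction)
open import Relation.Nullary.Decidable
  using (⌊_⌋; ¬?; _×-dec_; _→-dec_; decidable-stable; toWitness; map′)
open import Relation.Unary using (Decidable)

-- In `H` an edge of L is charged through `w`, by its potential difference, and not through `ρ`, by
-- the number of members it enters. Uncrossing leaves every such charge unchanged because `w` is
-- modular, while `ρ` is only submodular. The charge `cut` t = max (t - 1, 0) is minus the minimum
-- of z (1 - t) over z = 0, 1. So `H` is the Lagrangian dual of minimising |Z| subject to h C being
-- at most the sum of `w` e C over Z. The passage between `w` and `ρ` is made by `realize` on the
-- primal side and, for chains only, by `chain-ρ` on the dual side. Merging two dual families is a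
-- form of discrete midpoint concavity. For each vertex the number of members avoiding it, averaged
-- over the two families, is rounded up in one new family and down in the other. Integers at
-- distance at most 1 lie on one linear piece of `cut`, so the rounding costs nothing and the whole
-- argument stays over ℤ.

-- Linear arithmetic over the integers.

+-interchange : ∀ a b c d → a + b + (c + d) ≡ a + c + (b + d)
+-interchange = interchange +-commutativeSemigroup

ℚ-interchange : ∀ a b c d → (a ℚ.+ b) ℚ.+ (c ℚ.+ d) ≡ (a ℚ.+ c) ℚ.+ (b ℚ.+ d)
ℚ-interchange = interchange (AbelianGroup.commutativeSemigroup ℚ.+-0-abelianGroup)

-- Linear inequalities are certified in this form: known inequalities are added with `+-mono-≤`, and
-- the ring solver checks that both sides leave the same difference.
≤-from : ∀ {a b c d} → c ≤ d → b - a ≡ d - c → a ≤ b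
≤-from {a} {b} c≤d eq = 0≤i-j⇒j≤i (subst (0ℤ ≤_) (sym eq) (i≤j⇒0≤j-i c≤d))

≰⇒1+≤ : ∀ {a b} → ¬ (a ≤ b) → b + 1ℤ ≤ a
≰⇒1+≤ {a} {b} a≰b = subst (_≤ a) (+-comm 1ℤ b) (i<j⇒suc[i]≤j (≰⇒> a≰b))

1+≰ : ∀ {a} → ¬ (a + 1ℤ ≤ a)
1+≰ {a} h with ≤-from {1ℤ} {0ℤ} h (solve (a ∷ []))
... | +≤+ ()

0≤⇒≤+ˡ : ∀ {a} b → 0ℤ ≤ a → b ≤ a + b
0≤⇒≤+ˡ {a} b 0≤a = subst (_≤ a + b) (+-identityˡ b) (+-monoˡ-≤ b 0≤a)

+-swapˡ : ∀ a b c → a + (b + c) ≡ (b + a) + c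
+-swapˡ = solve-∀

flip-≥0 : ∀ {a b} → a - b ≤ 1ℤ → 0ℤ ≤ 1ℤ + b - a
flip-≥0 {a} {b} h = ≤-from h (solve (a ∷ b ∷ []))

flip-≤1 : ∀ {a b} → 0ℤ ≤ a - b → 1ℤ + b - a ≤ 1ℤ
flip-≤1 {a} {b} h = ≤-from h (solve (a ∷ b ∷ []))

regroup : ∀ a b c d → (a - b) - (c - d) ≡ (a - c) - (b - d)
regroup = solve-∀

unit-gap : ∀ {a b} → 0ℤ ≤ b → a ≤ 1ℤ → a - b ≤ 1ℤ
unit-gap {a} {b} p q = ≤-from (+-mono-≤ p q) (solve (a ∷ b ∷ []))

neg-gap : ∀ a b {x y} → x - y ≡ a - b → y - x ≡ b - a
neg-gap a b {x} {y} eq = trans (anti y x) (trans (cong -_ eq) (sym (anti b a)))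
  where
  anti : ∀ x y → x - y ≡ - (y - x)
  anti = solve-∀

difference-of-sums : ∀ a b c d → a - b + (c - d) ≡ a + c - (b + d)
difference-of-sums = solve-∀

expand : ∀ k r → (1ℤ + k) * (r + 1ℤ) - k * r ≡ r + (k + 1ℤ)
expand = solve-∀

-swap : ∀ a b c → a - b - c ≡ a - c - b
-swap = solve-∀

≤+⇒-≤ : ∀ {a b c} → a ≤ b + c → a - b ≤ c
≤+⇒-≤ {a} {b} {c} h = ≤-from h (solve (a ∷ b ∷ c ∷ []))

-≤⇒≤+ : ∀ {a b c} → a - b ≤ c → a ≤ b + c
-≤⇒≤+ {a} {b} {c} h = ≤-from h (solve (a ∷ b ∷ c ∷ []))

drop-nonneg : ∀ {p a b} → 0ℤ ≤ p → a ≤ b - p → a ≤ b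
drop-nonneg {p} {a} {b} 0≤p h = ≤-from (+-mono-≤ 0≤p h) (solve (p ∷ a ∷ b ∷ []))

1+≰⇒≤ : ∀ {a b} → ¬ (a + 1ℤ ≤ b) → b ≤ a
1+≰⇒≤ {a} {b} h = ≤-from (≰⇒1+≤ h) (solve (a ∷ b ∷ []))

tighten : ∀ l s {t p c} → t ≤ p → l ≤ s - c - p → 1ℤ + l ≤ s - (t - 1ℤ + c)
tighten l s {t} {p} {c} t≤p h = ≤-from (+-mono-≤ t≤p h) (solve (l ∷ s ∷ t ∷ p ∷ c ∷ []))

i≤∣i∣ : ∀ i → i ≤ + ∣ i ∣
i≤∣i∣ (+ n)    = ≤-refl
i≤∣i∣ -[1+ n ] = -≤+

enter-arith : ∀ r {q w ρ} → r + 1ℤ ≤ q - w → q ≤ ρ + r → 1ℤ + w ≤ ρ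
enter-arith r {q} {w} {ρ} p p' = ≤-from (+-mono-≤ p p') (solve (r ∷ q ∷ w ∷ ρ ∷ []))

-- The sum of the seven premises is the contradiction in `keep-or-drop`. There `a`, `b`, `c`, `d`
-- are the values of `q` at X, Y, X ∩ Y, X ∪ Y; the `r` and `s` count the entering edges other than
-- e, and the `ρ` count e.
chain-arith : ∀ a b w c d r₁ r₂ s₁ s₂ ρ₁ ρ₂ → a + b ≤ c + d → c ≤ ρ₁ + r₁ → d ≤ ρ₂ + r₂ →
              ρ₁ + ρ₂ ≤ 1ℤ + w → r₁ + r₂ ≤ s₁ + s₂ → s₁ + 1ℤ ≤ a → s₂ + 1ℤ ≤ b - w →
              a + b + 1ℤ ≤ a + b
chain-arith a b w c d r₁ r₂ s₁ s₂ ρ₁ ρ₂ h₁ h₂ h₃ h₄ h₅ h₆ h₇ =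
  ≤-from (+-mono-≤ h₁ (+-mono-≤ h₂ (+-mono-≤ h₃ (+-mono-≤ h₄ (+-mono-≤ h₅ (+-mono-≤ h₆ h₇))))))
         (solve (a ∷ b ∷ w ∷ c ∷ d ∷ r₁ ∷ r₂ ∷ s₁ ∷ s₂ ∷ ρ₁ ∷ ρ₂ ∷ []))

enter-arith₀ : ∀ r {q ρ} → r + 1ℤ ≤ q → q ≤ ρ + r → 1ℤ ≤ ρ
enter-arith₀ r {q} {ρ} p p' = ≤-from (+-mono-≤ p p') (solve (r ∷ q ∷ ρ ∷ []))

0≤⇒≤+ʳ : ∀ a {b} → 0ℤ ≤ b → a ≤ a + b
0≤⇒≤+ʳ a {b} 0≤b = ≤-trans (0≤⇒≤+ˡ a 0≤b) (≤-reflexive (+-comm b a))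

+-congˡ : ∀ a {b c} → b ≡ c → a + b ≡ a + c
+-congˡ a = cong (λ z → a + z)

+-congʳ : ∀ a {b c} → b ≡ c → b + a ≡ c + a
+-congʳ a = cong (λ z → z + a)

-- Finite integer sums.

∑ : {A : Set} → List A → (A → ℤ) → ℤ
∑ []       F = 0ℤ
∑ (x ∷ xs) F = F x + ∑ xs F

module _ {A : Set} where

  ∑-mono : (xs : List A) {F G : A → ℤ} → (∀ x → F x ≤ G x) → ∑ xs F ≤ ∑ xs G
  ∑-mono []       h = ≤-refl
  ∑-mono (x ∷ xs) h = +-mono-≤ (h x) (∑-mono xs h)

  ∑-cong : (xs : List A) {F G : A → ℤ} → (∀ x → F x ≡ G x) → ∑ xs F ≡ ∑ xs G
  ∑-cong []       h = refl
  ∑-cong (x ∷ xs) h = cong₂ _+_ (h x) (∑-cong xs h)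

  ∑-+ : (xs : List A) (F G : A → ℤ) → ∑ xs (λ x → F x + G x) ≡ ∑ xs F + ∑ xs G
  ∑-+ []       F G = refl
  ∑-+ (x ∷ xs) F G = trans (+-congˡ (F x + G x) (∑-+ xs F G)) (+-interchange (F x) (G x) (∑ xs F) (∑ xs G))

  ∑-neg : (xs : List A) (F : A → ℤ) → ∑ xs (λ x → - F x) ≡ - ∑ xs F
  ∑-neg []       F = refl
  ∑-neg (x ∷ xs) F = trans (+-congˡ (- F x) (∑-neg xs F)) (sym (neg-distrib-+ (F x) (∑ xs F)))

  ∑-minus : (xs : List A) (F G : A → ℤ) → ∑ xs (λ x → F x - G x) ≡ ∑ xs F - ∑ xs G
  ∑-minus xs F G = trans (∑-+ xs F (λ x → - G x)) (+-congˡ (∑ xs F) (∑-neg xs G))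

  ∑-++ : (xs ys : List A) (F : A → ℤ) → ∑ (xs ++ ys) F ≡ ∑ xs F + ∑ ys F
  ∑-++ []       ys F = sym (+-identityˡ _)
  ∑-++ (x ∷ xs) ys F = trans (+-congˡ (F x) (∑-++ xs ys F)) (sym (+-assoc (F x) _ _))

  ∑-nonneg : (xs : List A) {F : A → ℤ} → (∀ x → 0ℤ ≤ F x) → 0ℤ ≤ ∑ xs F
  ∑-nonneg []       h = ≤-refl
  ∑-nonneg (x ∷ xs) h = +-mono-≤ (h x) (∑-nonneg xs h)

  ∑-* : (xs : List A) (c : ℤ) (F : A → ℤ) → ∑ xs (λ x → c * F x) ≡ c * ∑ xs F
  ∑-* []       c F = sym (*-zeroʳ c)
  ∑-* (x ∷ xs) c F = trans (+-congˡ (c * F x) (∑-* xs c F)) (sym (*-distribˡ-+ c (F x) _))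

  ∑-replicate : ∀ k (x : A) (F : A → ℤ) → ∑ (replicate k x) F ≡ + k * F x
  ∑-replicate zero    x F = refl
  ∑-replicate (suc k) x F = trans (+-congˡ (F x) (∑-replicate k x F)) (sym (suc-* (+ k) (F x)))

∑-0 : {A : Set} (xs : List A) → ∑ xs (λ _ → 0ℤ) ≡ 0ℤ
∑-0 []       = refl
∑-0 (x ∷ xs) = trans (+-identityˡ _) (∑-0 xs)

∑-swap : {A B : Set} (xs : List A) (ys : List B) (F : A → B → ℤ) →
         ∑ xs (λ x → ∑ ys (F x)) ≡ ∑ ys (λ y → ∑ xs (λ x → F x y))
∑-swap []       ys F = sym (∑-0 ys)
∑-swap (x ∷ xs) ys F =
  trans (+-congˡ (∑ ys (F x)) (∑-swap xs ys F))
        (sym (∑-+ ys (F x) (λ y → ∑ xs (λ x → F x y))))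

-- Indicators and set membership.

ι : Bool → ℤ
ι true  = 1ℤ
ι false = 0ℤ

0≤ι : ∀ b → 0ℤ ≤ ι b
0≤ι true  = +≤+ z≤n
0≤ι false = +≤+ z≤n

isIn-lookup : ∀ {k} (S : Subset k) v → isIn S v ≡ lookup S v
isIn-lookup S v with lookup S v
... | true  = refl
... | false = refl

isIn-∩ : ∀ {k} (X Y : Subset k) v → isIn (X ∩ Y) v ≡ isIn X v ∧ isIn Y v
isIn-∩ X Y v rewrite isIn-lookup (X ∩ Y) v | isIn-lookup X v | isIn-lookup Y v =
  lookup-zipWith _∧_ v X Y

isIn-∪ : ∀ {k} (X Y : Subset k) v → isIn (X ∪ Y) v ≡ isIn X v ∨ isIn Y v
isIn-∪ X Y v rewrite isIn-lookup (X ∪ Y) v | isIn-lookup X v | isIn-lookup Y v =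
  lookup-zipWith _∨_ v X Y

isIn-⊆ : ∀ {k} {X Y : Subset k} → X ⊆ Y → ∀ v → isIn X v ≡ true → isIn Y v ≡ true
isIn-⊆ {X = X} {Y} X⊆Y v h = trans (isIn-lookup Y v)
  ([]=⇒lookup (X⊆Y (lookup⇒[]= v X (trans (sym (isIn-lookup X v)) h))))

∑-⊑ : {A : Set} {xs ys : List A} → xs ⊑ ys → {F : A → ℤ} → (∀ x → 0ℤ ≤ F x) → ∑ xs F ≤ ∑ ys F
∑-⊑ []ₛ F≥0 = ≤-refl
∑-⊑ {ys = x ∷ ys} (.x ∷ʳ xs⊑ys) {F} F≥0 = ≤-trans (∑-⊑ xs⊑ys F≥0) (0≤⇒≤+ˡ (∑ ys F) (F≥0 x))
∑-⊑ {xs = x ∷ _} (refl ∷ₛ xs⊑ys) {F} F≥0 = +-monoʳ-≤ (F x) (∑-⊑ xs⊑ys F≥0)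

-- The piecewise linear charge `cut`.

-- The convex function through which a potential difference enters the dual objective.
cut : ℤ → ℤ
cut t = (t - 1ℤ) ⊔ 0ℤ

cut-≥0 : ∀ t → 0ℤ ≤ cut t
cut-≥0 t = i≤j⊔i (t - 1ℤ) 0ℤ

cut-≥ : ∀ t → t - 1ℤ ≤ cut t
cut-≥ t = i≤i⊔j (t - 1ℤ) 0ℤ

cut-≤1 : ∀ {t} → t ≤ 1ℤ → cut t ≡ 0ℤ
cut-≤1 {t} t≤1 = i≤j⇒i⊔j≡j (≤-from t≤1 (solve (t ∷ [])))

cut-≥1 : ∀ {t} → 1ℤ ≤ t → cut t ≡ t - 1ℤ
cut-≥1 {t} 1≤t = i≥j⇒i⊔j≡i (≤-from 1≤t (solve (t ∷ [])))

1≰⇒≤0 : ∀ {a} → ¬ (1ℤ ≤ a) → a ≤ 0ℤ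
1≰⇒≤0 {a} h = ≤-from (≰⇒1+≤ h) (solve (a ∷ []))

≤0⇒≤1 : ∀ {a} → a ≤ 0ℤ → a ≤ 1ℤ
≤0⇒≤1 h = ≤-trans h (+≤+ z≤n)

close-≤1 : ∀ {a b} → a ≤ 0ℤ → b - a ≤ 1ℤ → b ≤ 1ℤ
close-≤1 {a} {b} h k = ≤-from (+-mono-≤ h k) (solve (a ∷ b ∷ []))

≤1⇒cut-sum≤ : ∀ {a b a' b'} → a' ≤ 1ℤ → b' ≤ 1ℤ → cut a' + cut b' ≤ cut a + cut b
≤1⇒cut-sum≤ {a} {b} p q = ≤-trans (≤-reflexive (cong₂ _+_ (cut-≤1 p) (cut-≤1 q)))
                                  (+-mono-≤ (cut-≥0 a) (cut-≥0 b))

half-≤-arith : ∀ k {x y} → k + 1ℤ + 1ℤ ≤ x → x - y ≤ 1ℤ → x + y ≤ 1ℤ + k + 1ℤ → 1ℤ + k ≤ 0ℤ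
half-≤-arith k {x} {y} p q r = ≤-from (+-mono-≤ p (+-mono-≤ p (+-mono-≤ q r))) (solve (k ∷ x ∷ y ∷ []))

-- This makes `bisect` terminate. If x were at least k + 2, then y would be at least k + 1, and the
-- sum at least 2k + 3.
half-≤ : ∀ x y k → x - y ≤ 1ℤ → x + y ≤ + suc k + 1ℤ → x ≤ + k + 1ℤ
half-≤ x y k d s with x ≤? + k + 1ℤ
... | yes p = p
... | no  p = contradiction (half-≤-arith (+ k) {x} {y} (≰⇒1+≤ p) d s) λ { (+≤+ ()) }

-- Integrality turns concavity into progress: of two families with total value at least 2a + 1, one
-- has value at least a + 1.
pigeon : ∀ {a x y} → a + (a + 1ℤ) ≤ x + y → ¬ (a + 1ℤ ≤ x) → a + 1ℤ ≤ y
pigeon {a} {x} {y} h p = ≤-from (+-mono-≤ h (≰⇒1+≤ p)) (solve (a ∷ x ∷ y ∷ []))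

-- `cut` is convex with its only breakpoint at 1. If one of a', b' is at most 0, the other is at
-- most 1 and both charges vanish. Otherwise both are at least 1, where `cut` is affine and bounds
-- itself from below everywhere.
cut-balanced : ∀ a b a' b' → a + b ≡ a' + b' → a' - b' ≤ 1ℤ → b' - a' ≤ 1ℤ →
               cut a' + cut b' ≤ cut a + cut b
cut-balanced a b a' b' eq d d' with 1ℤ ≤? a' | 1ℤ ≤? b'
... | yes p | yes q = let open ≤-Reasoning in begin
  cut a' + cut b'          ≡⟨ cong₂ _+_ (cut-≥1 p) (cut-≥1 q) ⟩
  a' - 1ℤ + (b' - 1ℤ)      ≡⟨ +-interchange a' _ b' _ ⟩
  a' + b' + (- 1ℤ + - 1ℤ)  ≡⟨ +-congʳ _ eq ⟨
  a + b + (- 1ℤ + - 1ℤ)    ≡⟨ +-interchange a (- 1ℤ) b _ ⟨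
  a - 1ℤ + (b - 1ℤ)        ≤⟨ +-mono-≤ (cut-≥ a) (cut-≥ b) ⟩
  cut a + cut b            ∎
... | no p  | _     = ≤1⇒cut-sum≤ {a} {b} (≤0⇒≤1 (1≰⇒≤0 p)) (close-≤1 {a'} {b'} (1≰⇒≤0 p) d')
... | yes _ | no q  = ≤1⇒cut-sum≤ {a} {b} (close-≤1 {b'} {a'} (1≰⇒≤0 q) d) (≤0⇒≤1 (1≰⇒≤0 q))

ι≤1 : ∀ b → ι b ≤ 1ℤ
ι≤1 true  = ≤-refl
ι≤1 false = +≤+ z≤n

scale-arith : ∀ k {y b} → y ≤ (1ℤ + k) * b → b ≤ 1ℤ → y - 1ℤ ≤ k * b
scale-arith k {y} {b} p q = ≤-from (+-mono-≤ p q) (solve (k ∷ y ∷ b ∷ []))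

-- Of `suc k` copies of a set one is free, because `cut` deducts 1; an edge entering the set pays
-- for the other k.
cut-scale : ∀ k {x} b → x ≤ ι b → cut (+ suc k * x) ≤ + k * ι b
cut-scale k {x} b x≤b = ⊔-lub (scale-arith (+ k) (*-monoˡ-≤-nonNeg (+ suc k) x≤b) (ι≤1 b))
  (subst (_≤ + k * ι b) (*-zeroʳ (+ k)) (*-monoˡ-≤-nonNeg (+ k) (0≤ι b)))

-- The relations between indicators used below involve at most four Booleans, mostly the memberships
-- of the ends of one edge in two sets, so evaluating a decision procedure proves them.
∀Bool? : {P : Bool → Set} → (∀ b → Dec (P b)) → Dec (∀ b → P b)
∀Bool? {P} P? = map′ (λ (f , t) → λ { false → f ; true → t }) (λ h → h false , h true)
                     (P? false ×-dec P? true)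

-- Uncrossing a family into a chain, and splitting a chain in two.

module _ {k : ℕ} where

  -- Carrying the join on towards the larger members makes a single pass enough: the meet left
  -- behind is contained in everything that follows.
  insert : Subset k → List (Subset k) → List (Subset k)
  insert X []       = X ∷ []
  insert X (C ∷ cs) = (C ∩ X) ∷ insert (C ∪ X) cs

  uncross : List (Subset k) → List (Subset k)
  uncross = foldr insert []

  Chain : List (Subset k) → Set
  Chain = AllPairs _⊆_

  insert-⊇ : ∀ {Z X cs} → Z ⊆ X → All (Z ⊆_) cs → All (Z ⊆_) (insert X cs)
  insert-⊇ Z⊆X []ₐ          = Z⊆X ∷ₐ []ₐ
  insert-⊇ {Z} {X} {C ∷ _} Z⊆X (Z⊆C ∷ₐ Z⊆cs) =
    (λ z∈Z → x∈p∩q⁺ (Z⊆C z∈Z , Z⊆X z∈Z)) ∷ₐ insert-⊇ (⊆-trans Z⊆C (p⊆p∪q X)) Z⊆cs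

  insert-chain : ∀ X {cs} → Chain cs → Chain (insert X cs)
  insert-chain X []ₚ = []ₐ ∷ₚ []ₚ
  insert-chain X {C ∷ cs} (C⊆cs ∷ₚ chain) =
    insert-⊇ (⊆-trans (p∩q⊆p C X) (p⊆p∪q X)) (All.map (⊆-trans (p∩q⊆p C X)) C⊆cs)
    ∷ₚ insert-chain (C ∪ X) chain

  uncross-chain : ∀ cs → Chain (uncross cs)
  uncross-chain []       = []ₚ
  uncross-chain (C ∷ cs) = insert-chain C (uncross-chain cs)

  Modular : (Subset k → ℤ) → Set
  Modular F = ∀ X Y → F X + F Y ≡ F (X ∩ Y) + F (X ∪ Y)

  insert-modular : ∀ {F} → Modular F → ∀ X cs → ∑ (insert X cs) F ≡ F X + ∑ cs F
  insert-modular     mod X []       = refl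
  insert-modular {F} mod X (C ∷ cs) = begin
    F (C ∩ X) + ∑ (insert (C ∪ X) cs) F  ≡⟨ +-congˡ (F (C ∩ X)) (insert-modular mod (C ∪ X) cs) ⟩
    F (C ∩ X) + (F (C ∪ X) + ∑ cs F)     ≡⟨ +-assoc (F (C ∩ X)) _ _ ⟨
    F (C ∩ X) + F (C ∪ X) + ∑ cs F       ≡⟨ +-congʳ (∑ cs F) (mod C X) ⟨
    F C + F X + ∑ cs F                   ≡⟨ +-swapˡ (F X) (F C) _ ⟨
    F X + (F C + ∑ cs F)                 ∎
    where open ≡-Reasoning

  uncross-modular : ∀ {F} → Modular F → ∀ cs → ∑ (uncross cs) F ≡ ∑ cs F
  uncross-modular mod []       = refl
  uncross-modular {F} mod (C ∷ cs) =
    trans (insert-modular mod C (uncross cs)) (+-congˡ (F C) (uncross-modular mod cs))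

  Submodular : (Subset k → ℤ) → Set
  Submodular F = ∀ X Y → F (X ∩ Y) + F (X ∪ Y) ≤ F X + F Y

  ∑-submodular : ∀ {A : Set} (xs : List A) {G : A → Subset k → ℤ} → (∀ x → Submodular (G x)) →
                 Submodular (λ C → ∑ xs (λ x → G x C))
  ∑-submodular xs sub X Y = begin
    ∑ xs _ + ∑ xs _     ≡⟨ ∑-+ xs _ _ ⟨
    ∑ xs _              ≤⟨ ∑-mono xs (λ x → sub x X Y) ⟩
    ∑ xs _              ≡⟨ ∑-+ xs _ _ ⟩
    ∑ xs _ + ∑ xs _     ∎
    where open ≤-Reasoning

  -- If o members of an increasing chain avoid v, they are the first o, so the two lists receive o/2
  -- of them, rounded up and rounded down respectively.
  halve : List (Subset k) → List (Subset k) × List (Subset k)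
  halve []       = [] , []
  halve (C ∷ cs) = C ∷ proj₂ (halve cs) , proj₁ (halve cs)

  halve-∑ : ∀ F cs → ∑ (proj₁ (halve cs)) F + ∑ (proj₂ (halve cs)) F ≡ ∑ cs F
  halve-∑ F []       = refl
  halve-∑ F (C ∷ cs) = begin
    F C + ∑ (proj₂ (halve cs)) F + ∑ (proj₁ (halve cs)) F    ≡⟨ +-assoc (F C) _ _ ⟩
    F C + (∑ (proj₂ (halve cs)) F + ∑ (proj₁ (halve cs)) F)  ≡⟨ +-congˡ (F C) (+-comm (∑ (proj₂ (halve cs)) F) _) ⟩
    F C + (∑ (proj₁ (halve cs)) F + ∑ (proj₂ (halve cs)) F)  ≡⟨ +-congˡ (F C) (halve-∑ F cs) ⟩
    F C + ∑ cs F                                             ∎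
    where open ≡-Reasoning

  halve-All : ∀ {P : Subset k → Set} {cs} → All P cs →
              All P (proj₁ (halve cs)) × All P (proj₂ (halve cs))
  halve-All []ₐ       = []ₐ , []ₐ
  halve-All {P} (p ∷ₐ ps) = let (as , bs) = halve-All {P} ps in p ∷ₐ bs , as

  -- Avoiding members are counted rather than containing ones because they sit at the front, where
  -- the alternation starts. Each further one turns a gap d into 1 - d, so the gap stays in the
  -- one-sided range 0 to 1.
  outside? : Fin k → Subset k → ℤ
  outside? v C = ι (not (isIn C v))

  ∑-outside-0 : ∀ v {cs} → All (λ C → isIn C v ≡ true) cs → ∑ cs (outside? v) ≡ 0ℤ
  ∑-outside-0 v []ₐ       = refl
  ∑-outside-0 v (p ∷ₐ ps) rewrite p = trans (+-identityˡ _) (∑-outside-0 v ps)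

  isIn-All : ∀ {X : Subset k} {cs} v → All (X ⊆_) cs → isIn X v ≡ true → All (λ C → isIn C v ≡ true) cs
  isIn-All v []ₐ v∈X = []ₐ
  isIn-All {X} {C ∷ _} v (X⊆C ∷ₐ X⊆cs) v∈X =
    isIn-⊆ {X = X} {C} X⊆C v v∈X ∷ₐ isIn-All v X⊆cs v∈X

  gap : Fin k → List (Subset k) → ℤ
  gap v cs = ∑ (proj₁ (halve cs)) (outside? v) - ∑ (proj₂ (halve cs)) (outside? v)

  -- Along an increasing chain the members avoiding v form a prefix.
  halve-gap : ∀ v {cs} → Chain cs → 0ℤ ≤ gap v cs × gap v cs ≤ 1ℤ
  halve-gap v []ₚ = ≤-refl , +≤+ z≤n
  halve-gap v {C ∷ cs} (C⊆cs ∷ₚ chain) with isIn C v in v∈C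
  ... | true  = ≤-reflexive (sym eq) , ≤-trans (≤-reflexive eq) (+≤+ z≤n)
    where
    all-in = halve-All {λ Y → isIn Y v ≡ true} (isIn-All {C} v C⊆cs v∈C)
    eq : 0ℤ + ∑ (proj₂ (halve cs)) (outside? v) - ∑ (proj₁ (halve cs)) (outside? v) ≡ 0ℤ
    eq rewrite ∑-outside-0 v (proj₁ all-in) | ∑-outside-0 v (proj₂ all-in) = refl
  ... | false = let (l , u) = halve-gap v chain in
    flip-≥0 {∑ (proj₁ (halve cs)) (outside? v)} u , flip-≤1 {∑ (proj₁ (halve cs)) (outside? v)} l

-- Edges against families of sets.

module _ (D : Digraph) where

  w : Fin (m D) → Subset (n D) → ℤ
  w e C = ι (isIn C (hd D e)) - ι (isIn C (tl D e))

  ρ : Fin (m D) → Subset (n D) → ℤ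
  ρ e C = ι (enters D C e)

  w-modular : ∀ e → Modular (w e)
  w-modular e X Y rewrite isIn-∩ X Y (hd D e) | isIn-∩ X Y (tl D e)
                        | isIn-∪ X Y (hd D e) | isIn-∪ X Y (tl D e) =
    toWitness {a? = ∀Bool? λ a → ∀Bool? λ b → ∀Bool? λ c → ∀Bool? λ d →
                    ι a - ι b + (ι c - ι d) ≟ ι (a ∧ c) - ι (b ∧ d) + (ι (a ∨ c) - ι (b ∨ d))}
      _ (isIn X (hd D e)) (isIn X (tl D e)) (isIn Y (hd D e)) (isIn Y (tl D e))

  ρ-submodular : ∀ e → Submodular (ρ e)
  ρ-submodular e X Y rewrite isIn-∩ X Y (hd D e) | isIn-∩ X Y (tl D e)
                           | isIn-∪ X Y (hd D e) | isIn-∪ X Y (tl D e) =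
    toWitness {a? = ∀Bool? λ a → ∀Bool? λ b → ∀Bool? λ c → ∀Bool? λ d →
                    ι ((a ∧ c) ∧ not (b ∧ d)) + ι ((a ∨ c) ∧ not (b ∨ d))
                    ≤? ι (a ∧ not b) + ι (c ∧ not d)}
      _ (isIn X (hd D e)) (isIn X (tl D e)) (isIn Y (hd D e)) (isIn Y (tl D e))

  ρ≥0 : ∀ e C → 0ℤ ≤ ρ e C
  ρ≥0 e C = 0≤ι (enters D C e)

  w≤ρ : ∀ e C → w e C ≤ ρ e C
  w≤ρ e C = toWitness {a? = ∀Bool? λ a → ∀Bool? λ b → ι a - ι b ≤? ι (a ∧ not b)}
                      _ (isIn C (hd D e)) (isIn C (tl D e))

  w-outside : ∀ e C → w e C ≡ outside? (tl D e) C - outside? (hd D e) C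
  w-outside e C = toWitness {a? = ∀Bool? λ a → ∀Bool? λ b → ι a - ι b ≟ ι (not b) - ι (not a)}
                            _ (isIn C (hd D e)) (isIn C (tl D e))

  -- With the potential of v defined as the number of members containing v, this is the potential of
  -- the head of e minus that of its tail.
  t : Fin (m D) → List (Subset (n D)) → ℤ
  t e cs = ∑ cs (w e)

  t-halve : ∀ e cs → t e (proj₁ (halve cs)) - t e (proj₂ (halve cs)) ≡ gap (tl D e) cs - gap (hd D e) cs
  t-halve e cs =
    trans (cong₂ _-_ (split (proj₁ (halve cs))) (split (proj₂ (halve cs))))
          (regroup (∑ (proj₁ (halve cs)) (outside? (tl D e))) _ _ _)
    where
    split : ∀ cs → t e cs ≡ ∑ cs (outside? (tl D e)) - ∑ cs (outside? (hd D e))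
    split cs = trans (∑-cong cs (w-outside e)) (∑-minus cs _ _)

  -- By `t-halve` this difference is a difference of two gaps, each of them 0 or 1.
  t-halve-≤1 : ∀ e {cs} → Chain cs →
               t e (proj₁ (halve cs)) - t e (proj₂ (halve cs)) ≤ 1ℤ ×
               t e (proj₂ (halve cs)) - t e (proj₁ (halve cs)) ≤ 1ℤ
  t-halve-≤1 e {cs} chain =
      subst (_≤ 1ℤ) (sym eq) (unit-gap {gap (tl D e) cs} (proj₁ gh) (proj₂ gt))
    , subst (_≤ 1ℤ) (sym (neg-gap (gap (tl D e) cs) (gap (hd D e) cs) {t e (proj₁ (halve cs))} eq))
                    (unit-gap {gap (hd D e) cs} (proj₁ gt) (proj₂ gh))
    where
    eq = t-halve e cs
    gt = halve-gap (tl D e) chain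
    gh = halve-gap (hd D e) chain

  -- H L h is the dual objective whose maximum over families is the minimum size of
  -- a sublist of L covering h.
  H : List (Fin (m D)) → (Subset (n D) → ℤ) → List (Subset (n D)) → ℤ
  H L h cs = ∑ cs h - ∑ L (λ e → cut (t e cs))

-- Sums over filtered lists and sums of extended integers.

module _ {A : Set} where

  ∑-filter : (P : A → Bool) (xs : List A) (F : A → ℤ) →
             ∑ (filterᵇ P xs) F ≡ ∑ xs (λ x → ι (P x) * F x)
  ∑-filter P []       F = refl
  ∑-filter P (x ∷ xs) F with P x
  ... | true  = cong₂ _+_ (sym (*-identityˡ (F x))) (∑-filter P xs F)
  ... | false = trans (∑-filter P xs F) (sym (+-identityˡ _))

  ∑-1 : (xs : List A) → ∑ xs (λ _ → 1ℤ) ≡ + length xs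
  ∑-1 []       = refl
  ∑-1 (x ∷ xs) = +-congˡ 1ℤ (∑-1 xs)

  length-filter-∑ : (P : A → Bool) (xs : List A) → + length (filterᵇ P xs) ≡ ∑ xs (ι ∘ P)
  length-filter-∑ P xs = trans (sym (∑-1 (filterᵇ P xs)))
    (trans (∑-filter P xs _) (∑-cong xs (λ x → *-identityʳ (ι (P x)))))

  ∑-single : ∀ {k} (g : Fin k → A) (F : A → ℤ) i → (∀ j → j ≢ i → F (g j) ≡ 0ℤ) →
             ∑ (tabulate g) F ≡ F (g i)
  ∑-single {suc k} g F Fin.zero    h =
    trans (+-congˡ (F (g Fin.zero)) (rest (g ∘ Fin.suc) λ j → h (Fin.suc j) λ ())) (+-identityʳ _)
    where
    rest : ∀ {k} (g : Fin k → A) → (∀ j → F (g j) ≡ 0ℤ) → ∑ (tabulate g) F ≡ 0ℤ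
    rest {zero}  g h = refl
    rest {suc k} g h = cong₂ _+_ (h Fin.zero) (rest (g ∘ Fin.suc) (h ∘ Fin.suc))
  ∑-single {suc k} g F (Fin.suc i) h =
    trans (cong₂ _+_ (h Fin.zero λ ()) (∑-single (g ∘ Fin.suc) F i λ j j≢i → h (Fin.suc j) λ { refl → j≢i refl }))
          (+-identityˡ _)

  sumE-≥ : {g : A → Maybe ℤ} {G : A → ℤ} → (∀ x b → g x ≡ just b → G x ≤ b) →
           ∀ xs {b} → sumE (map g xs) ≡ just b → ∑ xs G ≤ b
  sumE-≥     h []       refl = ≤-refl
  sumE-≥ {g} h (x ∷ xs) eq with g x in gx | sumE (map g xs) in gxs
  sumE-≥ {g} h (x ∷ xs) refl | just b | just s = +-mono-≤ (h x b gx) (sumE-≥ h xs gxs)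

  sumE-≤ : {f : A → Maybe ℤ} {G : A → ℤ} → (∀ x a → f x ≡ just a → a ≤ G x) →
           ∀ xs {a} → sumE (map f xs) ≡ just a → a ≤ ∑ xs G
  sumE-≤     h []       refl = ≤-refl
  sumE-≤ {f} h (x ∷ xs) eq with f x in fx | sumE (map f xs) in fxs
  sumE-≤ {f} h (x ∷ xs) refl | just a | just s = +-mono-≤ (h x a fx) (sumE-≤ h xs fxs)

  sumE-just : {g : A → Maybe ℤ} {G : A → ℤ} {xs : List A} →
              All (λ x → g x ≡ just (G x)) xs → sumE (map g xs) ≡ just (∑ xs G)
  sumE-just []ₐ       = refl
  sumE-just (p ∷ₐ ps) = cong₂ _⊕_ p (sumE-just ps)

  -- The slacks S are nonnegative, so a single infinite entry already lifts their sum to K. An upper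
  -- bound below K on that sum thus proves all entries finite.
  sumE-finite-or-large : {g : A → Maybe ℤ} {G S : A → ℤ} {K : ℤ} →
    (∀ x → g x ≡ just (G x) ⊎ K ≤ S x) → (∀ x → 0ℤ ≤ S x) →
    ∀ xs → sumE (map g xs) ≡ just (∑ xs G) ⊎ K ≤ ∑ xs S
  sumE-finite-or-large     h S≥0 []       = inj₁ refl
  sumE-finite-or-large {S = S} {K} h S≥0 (x ∷ xs) with h x | sumE-finite-or-large h S≥0 xs
  ... | inj₁ p | inj₁ q = inj₁ (cong₂ _⊕_ p q)
  ... | inj₂ p | _      = inj₂ (≤-trans p (0≤⇒≤+ʳ (S x) (∑-nonneg xs S≥0)))
  ... | inj₁ _ | inj₂ q = inj₂ (≤-trans q (0≤⇒≤+ˡ (∑ xs S) (S≥0 x)))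

  ∑-≥-member : {F : A → ℤ} {xs : List A} → All (λ x → 0ℤ ≤ F x) xs → All (λ x → F x ≤ ∑ xs F) xs
  ∑-≥-member []ₐ = []ₐ
  ∑-≥-member {F} {x ∷ xs} (p ∷ₐ ps) =
    0≤⇒≤+ʳ (F x) (nonneg ps)
    ∷ₐ All.map (λ le → ≤-trans le (0≤⇒≤+ˡ (∑ xs F) p)) (∑-≥-member ps)
    where
    nonneg : ∀ {xs} → All (λ x → 0ℤ ≤ F x) xs → 0ℤ ≤ ∑ xs F
    nonneg []ₐ       = ≤-refl
    nonneg (p ∷ₐ ps) = +-mono-≤ p (nonneg ps)

  ι-any-≤ : (P : A → Bool) (xs : List A) → ι (any P xs) ≤ ∑ xs (ι ∘ P)
  ι-any-≤ P []       = ≤-refl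
  ι-any-≤ P (x ∷ xs) with P x
  ... | true  = 0≤⇒≤+ʳ 1ℤ (∑-nonneg xs (0≤ι ∘ P))
  ... | false = ≤-trans (ι-any-≤ P xs) (≤-reflexive (sym (+-identityˡ _)))

-- Lists as multiplicity vectors; removing repetitions from a chain.

module _ {k : ℕ} where

  δ₌ : Fin k → Fin k → ℤ
  δ₌ i j = ι ⌊ i Fin.≟ j ⌋

  δ₌-refl : ∀ i → δ₌ i i ≡ 1ℤ
  δ₌-refl i with i Fin.≟ i
  ... | yes _ = refl
  ... | no ¬p = contradiction refl ¬p

  δ₌-≢ : ∀ {i j} → i ≢ j → δ₌ i j ≡ 0ℤ
  δ₌-≢ {i} {j} i≢j with i Fin.≟ j
  ... | yes p = contradiction p i≢j
  ... | no _  = refl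

  ∑-δ₌ : ∀ j (F : Fin k → ℤ) → ∑ (allFin k) (λ i → δ₌ i j * F i) ≡ F j
  ∑-δ₌ j F = trans (∑-single id _ j (λ i i≢j → cong (_* F i) (δ₌-≢ i≢j)))
                   (trans (cong (_* F j) (δ₌-refl j)) (*-identityˡ (F j)))

  cnt : List (Fin k) → Fin k → ℤ
  cnt xs i = ∑ xs (δ₌ i)

  cnt-≥0 : ∀ xs i → 0ℤ ≤ cnt xs i
  cnt-≥0 xs i = ∑-nonneg xs (λ j → 0≤ι ⌊ i Fin.≟ j ⌋)

  ∑-cnt : ∀ xs (F : Fin k → ℤ) → ∑ (allFin k) (λ i → cnt xs i * F i) ≡ ∑ xs F
  ∑-cnt xs F = begin
    ∑ (allFin k) (λ i → cnt xs i * F i)             ≡⟨ ∑-cong (allFin k) (λ i → distr i xs) ⟩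
    ∑ (allFin k) (λ i → ∑ xs (λ j → δ₌ i j * F i))  ≡⟨ ∑-swap (allFin k) xs (λ i j → δ₌ i j * F i) ⟩
    ∑ xs (λ j → ∑ (allFin k) (λ i → δ₌ i j * F i))  ≡⟨ ∑-cong xs (λ j → ∑-δ₌ j F) ⟩
    ∑ xs F                                          ∎
    where
    open ≡-Reasoning
    distr : ∀ i xs → cnt xs i * F i ≡ ∑ xs (λ j → δ₌ i j * F i)
    distr i []       = refl
    distr i (x ∷ xs) = trans (*-distribʳ-+ (F i) (δ₌ i x) (cnt xs i)) (+-congˡ (δ₌ i x * F i) (distr i xs))

  -- Capacities become parallel unit edges, so that choosing a sublist, which is what `realize`
  -- does, amounts to choosing an integral flow value for each edge.
  copies : (Fin k → ℕ) → List (Fin k) → List (Fin k)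
  copies c []       = []
  copies c (x ∷ xs) = replicate (c x) x ++ copies c xs

  ∑-copies : ∀ c xs (F : Fin k → ℤ) → ∑ (copies c xs) F ≡ ∑ xs (λ x → + c x * F x)
  ∑-copies c []       F = refl
  ∑-copies c (x ∷ xs) F = trans (∑-++ (replicate (c x) x) (copies c xs) F)
    (cong₂ _+_ (∑-replicate (c x) x F) (∑-copies c xs F))

  δ₌-sym : ∀ i j → δ₌ i j ≡ δ₌ j i
  δ₌-sym i j with i Fin.≟ j
  ... | yes refl = sym (δ₌-refl i)
  ... | no i≢j   = sym (δ₌-≢ (i≢j ∘ sym))

  cnt-copies : ∀ c i → cnt (copies c (allFin k)) i ≡ + c i
  cnt-copies c i = trans (∑-copies c (allFin k) (δ₌ i))
    (trans (∑-cong (allFin k) (λ j → trans (*-comm (+ c j) (δ₌ i j)) (cong (_* + c j) (δ₌-sym i j))))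
           (∑-δ₌ i (λ j → + c j)))

  cnt-filter : ∀ (P : Fin k → Bool) i → cnt (filterᵇ P (allFin k)) i ≡ ι (P i)
  cnt-filter P i = trans (∑-filter P (allFin k) (δ₌ i))
    (trans (∑-cong (allFin k) (λ j → trans (*-comm (ι (P j)) (δ₌ i j)) (cong (_* ι (P j)) (δ₌-sym i j))))
           (∑-δ₌ i (ι ∘ P)))

  -- In an increasing chain `¬ (C ⊂ B)` can only mean `C ≡ B`, so this test finds exactly the
  -- repetitions, and its positive answers are the evidence that `IsChain` asks for.
  squeeze : Subset k → List (Subset k) → List (Subset k)
  squeeze C []       = C ∷ []
  squeeze C (B ∷ cs) with C ⊂? B
  ... | yes _ = C ∷ squeeze B cs
  ... | no _  = squeeze C cs

  dedup : List (Subset k) → List (Subset k)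
  dedup []       = []
  dedup (C ∷ cs) = squeeze C cs

  ⊆∧⊄⇒≡ : ∀ {X Y : Subset k} → X ⊆ Y → ¬ (X ⊂ Y) → X ≡ Y
  ⊆∧⊄⇒≡ {X} {Y} X⊆Y X⊄Y = ⊆-antisym X⊆Y λ {x} x∈Y → back x x∈Y (x ∈? X)
    where
    back : ∀ x → x ∈ Y → Dec (x ∈ X) → x ∈ X
    back x x∈Y (yes p) = p
    back x x∈Y (no ¬p) = contradiction ((λ {y} → X⊆Y {y}) , x , x∈Y , ¬p) X⊄Y

  squeeze-All : ∀ {P : Subset k → Set} {C} cs → P C → All P cs → All P (squeeze C cs)
  squeeze-All []       p []ₐ = p ∷ₐ []ₐ
  squeeze-All {C = C} (B ∷ cs) p (q ∷ₐ qs) with C ⊂? B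
  ... | yes _ = p ∷ₐ squeeze-All cs q qs
  ... | no _  = squeeze-All cs p qs

  dedup-All : ∀ {P : Subset k → Set} {cs} → All P cs → All P (dedup cs)
  dedup-All []ₐ              = []ₐ
  dedup-All {P} {C ∷ cs} (p ∷ₐ ps) = squeeze-All {P} cs p ps

  ⊂-⊆-All : ∀ {X Y : Subset k} {cs} → X ⊂ Y → All (Y ⊆_) cs → All (X ⊂_) cs
  ⊂-⊆-All X⊂Y []ₐ = []ₐ
  ⊂-⊆-All {X} {Y} {C ∷ _} X⊂Y (Y⊆C ∷ₐ Y⊆cs) = ⊂-⊆-trans {i = X} {Y} {C} X⊂Y Y⊆C ∷ₐ ⊂-⊆-All X⊂Y Y⊆cs

  squeeze-⊂ : ∀ C cs → All (C ⊆_) cs → Chain cs → AllPairs _⊂_ (squeeze C cs)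
  squeeze-⊂ C []       _ _ = []ₐ ∷ₚ []ₚ
  squeeze-⊂ C (B ∷ cs) (C⊆B ∷ₐ C⊆cs) (B⊆cs ∷ₚ chain) with C ⊂? B
  ... | yes C⊂B = squeeze-All {C ⊂_} cs C⊂B (⊂-⊆-All C⊂B B⊆cs)
                  ∷ₚ squeeze-⊂ B cs B⊆cs chain
  ... | no _    = squeeze-⊂ C cs C⊆cs chain

  dedup-⊂ : ∀ {cs} → Chain cs → AllPairs _⊂_ (dedup cs)
  dedup-⊂ []ₚ                          = []ₚ
  dedup-⊂ {C ∷ cs} (C⊆cs ∷ₚ chain) = squeeze-⊂ C cs C⊆cs chain

  squeeze-∑ : ∀ {F : Subset k → ℤ} C cs → All (λ X → 0ℤ ≤ F X) cs → ∑ (squeeze C cs) F ≤ F C + ∑ cs F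
  squeeze-∑     C []       _ = ≤-refl
  squeeze-∑ {F} C (B ∷ cs) (p ∷ₐ ps) with C ⊂? B
  ... | yes _ = +-monoʳ-≤ (F C) (squeeze-∑ B cs ps)
  ... | no _  = ≤-trans (squeeze-∑ C cs ps) (+-monoʳ-≤ (F C) (0≤⇒≤+ˡ (∑ cs F) p))

  dedup-∑ : ∀ {F : Subset k → ℤ} cs → All (λ X → 0ℤ ≤ F X) cs → ∑ (dedup cs) F ≤ ∑ cs F
  dedup-∑ []       _         = ≤-refl
  dedup-∑ {F} (C ∷ cs) (p ∷ₐ ps) = squeeze-∑ {F} C cs ps

  squeeze-any : ∀ (P : Subset k → Bool) C cs → All (C ⊆_) cs → Chain cs →
                any P (squeeze C cs) ≡ P C ∨ any P cs
  squeeze-any P C []       _ _ = refl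
  squeeze-any P C (B ∷ cs) (C⊆B ∷ₐ C⊆cs) (B⊆cs ∷ₚ chain) with C ⊂? B
  ... | yes _   = cong (P C ∨_) (squeeze-any P B cs B⊆cs chain)
  ... | no C⊄B rewrite ⊆∧⊄⇒≡ C⊆B C⊄B =
    trans (squeeze-any P B cs B⊆cs chain) (absorb (P B) (any P cs))
    where
    absorb : ∀ a b → a ∨ b ≡ a ∨ (a ∨ b)
    absorb true  b = refl
    absorb false b = refl

  dedup-any : ∀ (P : Subset k → Bool) {cs} → Chain cs → any P (dedup cs) ≡ any P cs
  dedup-any P []ₚ                          = refl
  dedup-any P {C ∷ cs} (C⊆cs ∷ₚ chain) = squeeze-any P C cs C⊆cs chain

-- One edge along an increasing chain.

module _ (D : Digraph) (e : Fin (m D)) where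

  hd∈⇒∑ρ≡t : ∀ {cs} → All (λ C → isIn C (hd D e) ≡ true) cs → ∑ cs (ρ D e) ≡ t D e cs
  hd∈⇒∑ρ≡t []ₐ = refl
  hd∈⇒∑ρ≡t {C ∷ _} (p ∷ₐ ps) = cong₂ _+_ ρ≡w (hd∈⇒∑ρ≡t ps)
    where
    ρ≡w : ρ D e C ≡ w D e C
    ρ≡w rewrite p with isIn C (tl D e)
    ... | true  = refl
    ... | false = refl

  tl∈⇒∑ρ≡0 : ∀ {cs} → All (λ C → isIn C (tl D e) ≡ true) cs → ∑ cs (ρ D e) ≡ 0ℤ
  tl∈⇒∑ρ≡0 []ₐ = refl
  tl∈⇒∑ρ≡0 {C ∷ _} (p ∷ₐ ps) = cong₂ _+_ ρ≡0 (tl∈⇒∑ρ≡0 ps)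
    where
    ρ≡0 : ρ D e C ≡ 0ℤ
    ρ≡0 rewrite p with isIn C (hd D e)
    ... | true  = refl
    ... | false = refl

  covered : List (Subset (n D)) → Bool
  covered cs = any (λ C → enters D C e) cs

  -- An edge entering a member of an increasing chain leaves none.
  chain-ρ : ∀ {cs} → Chain cs → ∑ cs (ρ D e) ≤ ι (covered cs) + cut (t D e cs)
  chain-ρ []ₚ = +≤+ z≤n
  chain-ρ {C ∷ cs} (C⊆cs ∷ₚ chain) with isIn C (hd D e) in hd∈C | isIn C (tl D e) in tl∈C
  ... | true  | false = subst (λ z → 1ℤ + z ≤ 1ℤ + cut (1ℤ + t D e cs))
    (sym (hd∈⇒∑ρ≡t (isIn-All {X = C} (hd D e) C⊆cs hd∈C)))
    (-≤⇒≤+ {1ℤ + t D e cs} {1ℤ} (cut-≥ (1ℤ + t D e cs)))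
  ... | true  | true  rewrite tl∈⇒∑ρ≡0 (isIn-All {X = C} (tl D e) C⊆cs tl∈C) =
    +-mono-≤ (0≤ι (covered cs)) (cut-≥0 (0ℤ + t D e cs))
  ... | false | true  rewrite tl∈⇒∑ρ≡0 (isIn-All {X = C} (tl D e) C⊆cs tl∈C) =
    +-mono-≤ (0≤ι (covered cs)) (cut-≥0 (- 1ℤ + t D e cs))
  ... | false | false rewrite +-identityˡ (∑ cs (ρ D e)) | +-identityˡ (t D e cs) = chain-ρ chain

-- Capacity and net in-flow of a set.

module _ (D : Digraph) where

  private all = allFin (m D)

  scale-modular : ∀ a e X Y → a * w D e X + a * w D e Y ≡ a * w D e (X ∩ Y) + a * w D e (X ∪ Y)
  scale-modular a e X Y = trans (sym (*-distribˡ-+ a (w D e X) (w D e Y)))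
    (trans (cong (λ z → a * z) (w-modular D e X Y)) (*-distribˡ-+ a (w D e (X ∩ Y)) (w D e (X ∪ Y))))

  scale-submodular : ∀ (c : ℕ) e → Submodular (λ C → + c * ρ D e C)
  scale-submodular c e X Y = begin
    + c * ρ D e (X ∩ Y) + + c * ρ D e (X ∪ Y)  ≡⟨ *-distribˡ-+ (+ c) (ρ D e (X ∩ Y)) (ρ D e (X ∪ Y)) ⟨
    + c * (ρ D e (X ∩ Y) + ρ D e (X ∪ Y))      ≤⟨ *-monoˡ-≤-nonNeg (+ c) (ρ-submodular D e X Y) ⟩
    + c * (ρ D e X + ρ D e Y)                  ≡⟨ *-distribˡ-+ (+ c) (ρ D e X) (ρ D e Y) ⟩
    + c * ρ D e X + + c * ρ D e Y              ∎
    where open ≤-Reasoning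

  -- The largest net in-flow into C of a flow between f and f + c.
  capacity : (Fin (m D) → ℤ) → (Fin (m D) → ℕ) → Subset (n D) → ℤ
  capacity f c C = ∑ all (λ e → f e * w D e C + + c e * ρ D e C)

  flow : (Fin (m D) → ℤ) → Subset (n D) → ℤ
  flow x C = ∑ all (λ e → x e * w D e C)

  flow-submodular : ∀ x → Submodular (flow x)
  flow-submodular x = ∑-submodular all (λ e X Y → ≤-reflexive (sym (scale-modular (x e) e X Y)))

  capacity-submodular : ∀ f c → Submodular (capacity f c)
  capacity-submodular f c = ∑-submodular all λ e X Y → begin
    (f e * w D e (X ∩ Y) + + c e * ρ D e (X ∩ Y)) + (f e * w D e (X ∪ Y) + + c e * ρ D e (X ∪ Y))
      ≡⟨ +-interchange (f e * w D e (X ∩ Y)) _ (f e * w D e (X ∪ Y)) _ ⟩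
    (f e * w D e (X ∩ Y) + f e * w D e (X ∪ Y)) + (+ c e * ρ D e (X ∩ Y) + + c e * ρ D e (X ∪ Y))
      ≤⟨ +-mono-≤ (≤-reflexive (sym (scale-modular (f e) e X Y))) (scale-submodular (c e) e X Y) ⟩
    (f e * w D e X + f e * w D e Y) + (+ c e * ρ D e X + + c e * ρ D e Y)
      ≡⟨ +-interchange (f e * w D e X) (+ c e * ρ D e X) (f e * w D e Y) _ ⟨
    (f e * w D e X + + c e * ρ D e X) + (f e * w D e Y + + c e * ρ D e Y) ∎
    where open ≤-Reasoning

-- Covers and integral flows for a supermodular function on a lattice of sets.

module Lattice (D : Digraph) (𝒟 : Subset (n D) → Set) (𝒟? : Decidable 𝒟)
               (𝒟-∩ : ∀ {X Y} → 𝒟 X → 𝒟 Y → 𝒟 (X ∩ Y))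
               (𝒟-∪ : ∀ {X Y} → 𝒟 X → 𝒟 Y → 𝒟 (X ∪ Y)) where

  private
    V = Subset (n D)
    E = Fin (m D)

  Supermodular : (V → ℤ) → Set
  Supermodular h = ∀ {X Y} → 𝒟 X → 𝒟 Y → h X + h Y ≤ h (X ∩ Y) + h (X ∪ Y)

  insert-𝒟 : ∀ {X cs} → 𝒟 X → All 𝒟 cs → All 𝒟 (insert X cs)
  insert-𝒟 dX []ₐ        = dX ∷ₐ []ₐ
  insert-𝒟 dX (dC ∷ₐ ds) = 𝒟-∩ dC dX ∷ₐ insert-𝒟 (𝒟-∪ dC dX) ds

  uncross-𝒟 : ∀ {cs} → All 𝒟 cs → All 𝒟 (uncross cs)
  uncross-𝒟 []ₐ       = []ₐ
  uncross-𝒟 (d ∷ₐ ds) = insert-𝒟 d (uncross-𝒟 ds)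

  insert-∑ : ∀ {h} → Supermodular h → ∀ {X cs} → 𝒟 X → All 𝒟 cs → h X + ∑ cs h ≤ ∑ (insert X cs) h
  insert-∑     sup dX []ₐ = ≤-refl
  insert-∑ {h} sup {X} {C ∷ cs} dX (dC ∷ₐ ds) = begin
    h X + (h C + ∑ cs h)                 ≡⟨ +-swapˡ (h X) (h C) (∑ cs h) ⟩
    h C + h X + ∑ cs h                   ≤⟨ +-monoˡ-≤ (∑ cs h) (sup dC dX) ⟩
    h (C ∩ X) + h (C ∪ X) + ∑ cs h       ≡⟨ +-assoc (h (C ∩ X)) _ _ ⟩
    h (C ∩ X) + (h (C ∪ X) + ∑ cs h)     ≤⟨ +-monoʳ-≤ (h (C ∩ X)) (insert-∑ sup (𝒟-∪ dC dX) ds) ⟩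
    h (C ∩ X) + ∑ (insert (C ∪ X) cs) h  ∎
    where open ≤-Reasoning

  uncross-∑ : ∀ {h} → Supermodular h → ∀ {cs} → All 𝒟 cs → ∑ cs h ≤ ∑ (uncross cs) h
  uncross-∑     sup []ₐ = ≤-refl
  uncross-∑ {h} sup {C ∷ _} (d ∷ₐ ds) =
    ≤-trans (+-monoʳ-≤ (h C) (uncross-∑ sup ds)) (insert-∑ sup d (uncross-𝒟 ds))

  -- The two rounded midpoints of A and B: each edge keeps its total potential difference, shared as
  -- evenly as to within 1.
  record Balanced (A B : List V) : Set where
    field
      A' B'  : List V
      A'⊆𝒟   : All 𝒟 A'
      B'⊆𝒟   : All 𝒟 B'
      t-sum  : ∀ e → t D e A' + t D e B' ≡ t D e A + t D e B
      t-gap  : ∀ e → t D e A' - t D e B' ≤ 1ℤ × t D e B' - t D e A' ≤ 1ℤ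
      ∑-grow : ∀ {h} → Supermodular h → ∑ A h + ∑ B h ≤ ∑ A' h + ∑ B' h

  balance : ∀ {A B} → All 𝒟 A → All 𝒟 B → Balanced A B
  balance {A} {B} dA dB = record
    { A' = proj₁ (halve cs)
    ; B' = proj₂ (halve cs)
    ; A'⊆𝒟 = proj₁ (halve-All (uncross-𝒟 dAB))
    ; B'⊆𝒟 = proj₂ (halve-All (uncross-𝒟 dAB))
    ; t-sum = λ e → begin
        t D e (proj₁ (halve cs)) + t D e (proj₂ (halve cs))  ≡⟨ halve-∑ (w D e) cs ⟩
        t D e cs                                             ≡⟨ uncross-modular (w-modular D e) (A ++ B) ⟩
        t D e (A ++ B)                                       ≡⟨ ∑-++ A B (w D e) ⟩
        t D e A + t D e B                                    ∎
    ; t-gap = λ e → t-halve-≤1 D e (uncross-chain (A ++ B))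
    ; ∑-grow = λ {h} sup → ≤-trans (≤-reflexive (sym (∑-++ A B h)))
        (≤-trans (uncross-∑ sup dAB) (≤-reflexive (sym (halve-∑ h cs))))
    }
    where
    open ≡-Reasoning
    cs = uncross (A ++ B)
    dAB = ++⁺ dA dB

  -- Both parts of `H` move the right way: uncrossing can only raise the sum of the supermodular
  -- `h`, and balancing can only lower the convex charges.
  H-grow : ∀ {h} → Supermodular h → ∀ L {A B} (b : Balanced A B) →
           H D L h A + H D L h B ≤ H D L h (Balanced.A' b) + H D L h (Balanced.B' b)
  H-grow {h} sup L {A} {B} b = begin
    H D L h A + H D L h B                    ≡⟨ +-interchange (∑ A h) _ (∑ B h) _ ⟩
    ∑ A h + ∑ B h + (- cutsA + - cutsB)      ≤⟨ +-mono-≤ (∑-grow sup) neg-cuts ⟩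
    ∑ A' h + ∑ B' h + (- cutsA' + - cutsB')  ≡⟨ +-interchange (∑ A' h) (- cutsA') (∑ B' h) _ ⟨
    H D L h A' + H D L h B'                  ∎
    where
    open ≤-Reasoning
    open Balanced b
    cuts : List V → ℤ
    cuts cs = ∑ L (λ e → cut (t D e cs))
    cutsA = cuts A
    cutsB = cuts B
    cutsA' = cuts A'
    cutsB' = cuts B'
    cuts-≤ : cutsA' + cutsB' ≤ cutsA + cutsB
    cuts-≤ = begin
      cutsA' + cutsB'  ≡⟨ ∑-+ L _ _ ⟨
      ∑ L (λ e → cut (t D e A') + cut (t D e B'))  ≤⟨ ∑-mono L (λ e →
        cut-balanced (t D e A) (t D e B) (t D e A') (t D e B')
          (sym (t-sum e)) (proj₁ (t-gap e)) (proj₂ (t-gap e))) ⟩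
      ∑ L (λ e → cut (t D e A) + cut (t D e B))    ≡⟨ ∑-+ L _ _ ⟩
      cutsA + cutsB    ∎
    neg-cuts : - cutsA + - cutsB ≤ - cutsA' + - cutsB'
    neg-cuts = begin
      - cutsA + - cutsB      ≡⟨ neg-distrib-+ cutsA cutsB ⟨
      - (cutsA + cutsB)      ≤⟨ neg-mono-≤ cuts-≤ ⟩
      - (cutsA' + cutsB')    ≡⟨ neg-distrib-+ cutsA' cutsB' ⟩
      - cutsA' + - cutsB'    ∎

  -- H is concave along the potential difference of e.
  bisect : ∀ {h} → Supermodular h → ∀ L e {a} k {A B} → All 𝒟 A → All 𝒟 B →
           t D e A ≤ 0ℤ → a ≤ H D L h A → t D e B ≤ + k + 1ℤ → a + 1ℤ ≤ H D L h B →
           ∃ λ cs → All 𝒟 cs × t D e cs ≤ 1ℤ × a + 1ℤ ≤ H D L h cs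
  bisect sup L e zero {A} {B} dA dB tA HA tB HB = B , dB , tB , HB
  bisect {h} sup L e {a} (suc k) {A} {B} dA dB tA HA tB HB = go (a + 1ℤ ≤? H D L h A')
    where
    b = balance dA dB
    open Balanced b
    sum-≤ : t D e A + t D e B ≤ + suc k + 1ℤ
    sum-≤ = subst (t D e A + t D e B ≤_) (+-identityˡ _) (+-mono-≤ tA tB)
    A'+B'-≤ : t D e A' + t D e B' ≤ + suc k + 1ℤ
    A'+B'-≤ = ≤-trans (≤-reflexive (t-sum e)) sum-≤
    B'+A'-≤ : t D e B' + t D e A' ≤ + suc k + 1ℤ
    B'+A'-≤ = ≤-trans (≤-reflexive (+-comm (t D e B') (t D e A'))) A'+B'-≤
    go : Dec (a + 1ℤ ≤ H D L h A') → _
    go (yes p) = bisect sup L e k dA A'⊆𝒟 tA HA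
                   (half-≤ (t D e A') (t D e B') k (proj₁ (t-gap e)) A'+B'-≤) p
    go (no p)  = bisect sup L e k dA B'⊆𝒟 tA HA
                   (half-≤ (t D e B') (t D e A') k (proj₂ (t-gap e)) B'+A'-≤)
                   (pigeon {a} {H D L h A'} (≤-trans (+-mono-≤ HA HB) (H-grow sup L b)) p)

  -- `strong` is the hard half of duality and certifies that Z is smallest. The easy half enters
  -- later, as `weak-duality` for flows and chains.
  record Cover (L : List E) (h : V → ℤ) : Set where
    field
      Z      : List E
      Z⊑L    : Z ⊑ L
      covers : ∀ {C} → 𝒟 C → h C ≤ ∑ Z (λ e → ρ D e C)
      cs     : List V
      cs⊆𝒟   : All 𝒟 cs
      strong : + length Z ≤ H D L h cs

  super-sub : ∀ (h F : V → ℤ) → Supermodular h → Submodular F →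
              Supermodular (λ C → h C - F C)
  super-sub h F sup sub {X} {Y} dX dY = begin
    h X - F X + (h Y - F Y)                          ≡⟨ difference-of-sums (h X) (F X) (h Y) (F Y) ⟩
    h X + h Y - (F X + F Y)                          ≤⟨ +-mono-≤ (sup dX dY) (neg-mono-≤ (sub X Y)) ⟩
    h (X ∩ Y) + h (X ∪ Y) - (F (X ∩ Y) + F (X ∪ Y))  ≡⟨ difference-of-sums (h (X ∩ Y)) (F (X ∩ Y)) (h (X ∪ Y)) (F (X ∪ Y)) ⟨
    h (X ∩ Y) - F (X ∩ Y) + (h (X ∪ Y) - F (X ∪ Y))  ∎
    where open ≤-Reasoning

  uncovered? : ∀ (q r : V → ℤ) → (∀ {C} → 𝒟 C → q C ≤ r C) ⊎ (∃ λ C → 𝒟 C × r C + 1ℤ ≤ q C)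
  uncovered? q r with anySubset? (λ C → 𝒟? C ×-dec ¬? (q C ≤? r C))
  ... | yes (C , d , ¬q≤r) = inj₂ (C , d , ≰⇒1+≤ ¬q≤r)
  ... | no  none           = inj₁ λ {C} d → decidable-stable (q C ≤? r C) λ ¬q≤r → none (C , d , ¬q≤r)

  -- Repeating a violated set makes the dual objective unbounded.
  H-replicate : ∀ L {h} k {C} → ∑ L (λ e → ρ D e C) + 1ℤ ≤ h C →
                + k + 1ℤ ≤ H D L h (replicate (suc k) C)
  H-replicate L {h} k {C} viol = begin
    + k + 1ℤ                                      ≤⟨ 0≤⇒≤+ˡ (+ k + 1ℤ) (∑-nonneg L (λ e → ρ≥0 D e C)) ⟩
    r + (+ k + 1ℤ)                                ≡⟨ expand (+ k) r ⟨
    (1ℤ + + k) * (r + 1ℤ) - + k * r               ≤⟨ +-mono-≤ (*-monoˡ-≤-nonNeg (+ suc k) viol) (neg-mono-≤ cuts≤) ⟩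
    + suc k * h C - ∑ L (λ e → cut (t D e B))     ≡⟨ +-congʳ (- ∑ L (λ e → cut (t D e B))) (∑-replicate (suc k) C h) ⟨
    H D L h B                                     ∎
    where
    open ≤-Reasoning
    r = ∑ L (λ e → ρ D e C)
    B = replicate (suc k) C
    cuts≤ : ∑ L (λ e → cut (t D e B)) ≤ + k * r
    cuts≤ = begin
      ∑ L (λ e → cut (t D e B))     ≤⟨ ∑-mono L (λ e →
        subst (λ z → cut z ≤ + k * ρ D e C) (sym (∑-replicate (suc k) C (w D e))) (cut-scale k (enters D C e) (w≤ρ D e C))) ⟩
      ∑ L (λ e → + k * ρ D e C)     ≡⟨ ∑-* L (+ k) _ ⟩
      + k * r                       ∎

  -- Let Z₁ and A solve the contracted problem. If t(A) ≥ 1, then e ∷ Z₁ and A are optimal. If t(A)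
  -- ≤ 0, then A pays nothing for e, and either deleting e gives a cover no larger than Z₁, or some
  -- family over L has value above |Z₁|. In the latter case bisection between A and that family
  -- yields one which pays nothing for e and certifies e ∷ Z₁. `deleted` is conditional because L
  -- alone may fail to cover h.
  cover-∷ : ∀ e L {h} → Supermodular h → Cover L (λ C → h C - ρ D e C) →
            ((∀ {C} → 𝒟 C → h C ≤ ∑ L (λ e → ρ D e C)) → Cover L h) → Cover (e ∷ L) h
  cover-∷ e L {h} sup contracted deleted = result (1ℤ ≤? t D e A)
    where
    open Cover contracted
      renaming (Z to Z₁; Z⊑L to Z₁⊑L; covers to covers₁; cs to A; cs⊆𝒟 to A⊆𝒟; strong to strong₁)

    P = ∑ A (ρ D e)
    tA≤P : t D e A ≤ P
    tA≤P = ∑-mono A (w≤ρ D e)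

    strong-A : + length Z₁ ≤ H D L h A - P
    strong-A = ≤-trans strong₁ (≤-reflexive (trans
      (+-congʳ (- ∑ L (λ e → cut (t D e A))) (∑-minus A h (ρ D e)))
      (-swap (∑ A h) P _)))

    HA-≥ : + length Z₁ ≤ H D L h A
    HA-≥ = drop-nonneg {P} (∑-nonneg A (ρ≥0 D e)) strong-A

    covers-e∷Z₁ : ∀ {C} → 𝒟 C → h C ≤ ρ D e C + ∑ Z₁ (λ e → ρ D e C)
    covers-e∷Z₁ {C} d = -≤⇒≤+ {h C} {ρ D e C} (covers₁ d)

    H-slack : ∀ {cs} → t D e cs ≤ 1ℤ → H D (e ∷ L) h cs ≡ H D L h cs
    H-slack {cs} t≤1 = cong (λ z → ∑ cs h - z) (trans (+-congʳ cuts (cut-≤1 t≤1)) (+-identityˡ cuts))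
      where cuts = ∑ L (λ e → cut (t D e cs))

    with-e : ∃ (λ cs → All 𝒟 cs × t D e cs ≤ 1ℤ × + length Z₁ + 1ℤ ≤ H D L h cs) → Cover (e ∷ L) h
    with-e (cs , d , t≤1 , le') = record
      { Z = e ∷ Z₁ ; Z⊑L = refl ∷ₛ Z₁⊑L ; covers = covers-e∷Z₁ ; cs = cs ; cs⊆𝒟 = d
      ; strong = ≤-trans (≤-reflexive (+-comm 1ℤ (+ length Z₁))) (≤-trans le' (≤-reflexive (sym (H-slack {cs} t≤1)))) }

    bisect-from : t D e A ≤ 0ℤ → ∀ {B} → All 𝒟 B → + length Z₁ + 1ℤ ≤ H D L h B → Cover (e ∷ L) h
    -- Nothing is known about the potential difference of e in B; its absolute value serves as the
    -- initial bound from which `bisect` descends.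
    bisect-from tA≤0 {B} dB HB = with-e (bisect sup L e ℤ.∣ t D e B ∣ A⊆𝒟 dB tA≤0 HA-≥
      (≤-trans (i≤∣i∣ (t D e B)) (i≤i+j (+ ℤ.∣ t D e B ∣) 1ℤ)) HB)

    without-e : t D e A ≤ 0ℤ → Cover L h → Cover (e ∷ L) h
    without-e tA≤0 c with + length Z₁ + 1ℤ ≤? + length (Cover.Z c)
    ... | yes Z₁<Z₂ = bisect-from tA≤0 (Cover.cs⊆𝒟 c) (≤-trans Z₁<Z₂ (Cover.strong c))
    ... | no  Z₂≤Z₁ = record
      { Z = Cover.Z c ; Z⊑L = e ∷ʳ Cover.Z⊑L c
      ; covers = Cover.covers c
      -- The cover comes from deletion but its certificate from contraction: |Z₂| ≤ |Z₁| ≤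
      -- `H D L h A`.
      ; cs = A ; cs⊆𝒟 = A⊆𝒟
      ; strong = ≤-trans (1+≰⇒≤ Z₂≤Z₁) (≤-trans HA-≥ (≤-reflexive (sym (H-slack {A} (≤0⇒≤1 tA≤0))))) }

    result : Dec (1ℤ ≤ t D e A) → Cover (e ∷ L) h
    -- Beyond the breakpoint e is charged t - 1, while contraction has already deducted P ≥ t. The
    -- unit gained pays for e.
    result (yes 1≤t) = record
      { Z = e ∷ Z₁ ; Z⊑L = refl ∷ₛ Z₁⊑L ; covers = covers-e∷Z₁ ; cs = A ; cs⊆𝒟 = A⊆𝒟
      ; strong = ≤-trans (tighten (+ length Z₁) (∑ A h) tA≤P strong-A)
                   (≤-reflexive (cong (λ z → ∑ A h - (z + ∑ L (λ e → cut (t D e A)))) (sym (cut-≥1 1≤t)))) }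
    result (no 1≰t) with uncovered? h (λ C → ∑ L (λ e → ρ D e C))
    ... | inj₁ le' = without-e (1≰⇒≤0 1≰t) (deleted le')
    -- Deletion is infeasible here; |Z₁| + 1 copies of a violated set push the dual value above |Z₁|
    -- and take the place of its optimum.
    ... | inj₂ (C , d , viol) =
      bisect-from (1≰⇒≤0 1≰t) (replicate⁺ (suc (length Z₁)) d) (H-replicate L {h} (length Z₁) {C} viol)

  cover : ∀ L {h} → Supermodular h → (∀ {C} → 𝒟 C → h C ≤ ∑ L (λ e → ρ D e C)) → Cover L h
  cover [] sup le = record
    { Z = [] ; Z⊑L = []ₛ ; covers = le ; cs = [] ; cs⊆𝒟 = []ₐ ; strong = ≤-refl }
  cover (e ∷ L) {h} sup le = cover-∷ e L sup
    (cover L (super-sub h (ρ D e) sup (ρ-submodular D e)) (λ {C} d → ≤+⇒-≤ {h C} {ρ D e C} (le d)))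
    (cover L sup)

  -- The second premise holds exactly when e leaves Y, and then the right-hand side is 0.
  ρ-cross : ∀ e X Y → 1ℤ ≤ ρ D e X → 1ℤ + w D e Y ≤ ρ D e Y →
            ρ D e (X ∩ Y) + ρ D e (X ∪ Y) ≤ 1ℤ + w D e Y
  ρ-cross e X Y rewrite isIn-∩ X Y (hd D e) | isIn-∩ X Y (tl D e)
                      | isIn-∪ X Y (hd D e) | isIn-∪ X Y (tl D e) =
    toWitness {a? = ∀Bool? λ a → ∀Bool? λ b → ∀Bool? λ c → ∀Bool? λ d →
                    (1ℤ ≤? ι (a ∧ not b)) →-dec ((1ℤ + (ι c - ι d) ≤? ι (c ∧ not d)) →-dec
                    (ι ((a ∧ c) ∧ not (b ∧ d)) + ι ((a ∨ c) ∧ not (b ∨ d))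
                    ≤? 1ℤ + (ι c - ι d)))}
      _ (isIn X (hd D e)) (isIn X (tl D e)) (isIn Y (hd D e)) (isIn Y (tl D e))

  -- Otherwise e would enter X and leave Y, hence enter neither X ∩ Y nor X ∪ Y, and one of
  -- these two sets would violate le.
  keep-or-drop : ∀ e L {q} → Supermodular q →
                 (∀ {C} → 𝒟 C → q C ≤ ρ D e C + ∑ L (λ e → ρ D e C)) →
                 ∀ {X Y} → 𝒟 X → 𝒟 Y → ∑ L (λ e → ρ D e X) + 1ℤ ≤ q X →
                 ¬ (∑ L (λ e → ρ D e Y) + 1ℤ ≤ q Y - w D e Y)
  keep-or-drop e L {q} sup le {X} {Y} dX dY violX violY =
    1+≰ {q X + q Y} (chain-arith (q X) (q Y) (w D e Y) (q (X ∩ Y)) (q (X ∪ Y))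
      (r (X ∩ Y)) (r (X ∪ Y)) (r X) (r Y) (ρ D e (X ∩ Y)) (ρ D e (X ∪ Y))
      (sup dX dY) (le (𝒟-∩ dX dY)) (le (𝒟-∪ dX dY))
      (ρ-cross e X Y (enter-arith₀ (r X) violX (le dX))
                     (enter-arith (r Y) violY (le dY)))
      (∑-submodular L (ρ-submodular D) X Y) violX violY)
    where
    r : V → ℤ
    r C = ∑ L (λ e → ρ D e C)

  -- A feasibility theorem for unit edges, proved greedily: e is dropped if the remaining edges
  -- still cover `q`, and otherwise kept, with `q` lowered by the modular `w e`. By `keep-or-drop`
  -- one of the two choices preserves the covering condition.
  realize : ∀ L {q} → Supermodular q → (∀ {C} → 𝒟 C → q C ≤ ∑ L (λ e → ρ D e C)) →
            ∃ λ Z → Z ⊑ L × (∀ {C} → 𝒟 C → q C ≤ ∑ Z (λ e → w D e C))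
  realize [] sup le = [] , []ₛ , le
  realize (e ∷ L) {q} sup le
    with uncovered? q (λ C → ∑ L (λ e → ρ D e C))
       | uncovered? (λ C → q C - w D e C) (λ C → ∑ L (λ e → ρ D e C))
  ... | inj₁ le' | _        = let (Z , Z⊑L , h) = realize L sup le' in Z , e ∷ʳ Z⊑L , h
  ... | inj₂ _   | inj₁ le' =
    let (Z , Z⊑L , h) = realize L (super-sub q (w D e) sup
                          (λ X Y → ≤-reflexive (sym (w-modular D e X Y)))) le'
    in e ∷ Z , refl ∷ₛ Z⊑L , λ {C} d → -≤⇒≤+ {q C} {w D e C} (h d)
  ... | inj₂ (X , dX , vX) | inj₂ (Y , dY , vY) =
    contradiction vY (keep-or-drop e L sup le dX dY vX)

  -- The lower bound is shifted to 0 by subtracting the flow f from `q`, which keeps it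
  -- supermodular, and the capacities are unfolded into parallel edges for `realize`.
  integral-flow : ∀ (f : Fin (m D) → ℤ) (c : Fin (m D) → ℕ) {q} → Supermodular q →
    (∀ {C} → 𝒟 C → q C ≤ capacity D f c C) →
    ∃ λ x → (∀ e → f e ≤ x e × x e ≤ f e + + c e) × (∀ {C} → 𝒟 C → q C ≤ flow D x C)
  integral-flow f c {q} sup le = (λ e → f e + cnt Z e) , bounds , λ {C} d → begin
    q C                                               ≤⟨ -≤⇒≤+ {q C} {flow D f C} (Z-real d) ⟩
    flow D f C + ∑ Z (λ e → w D e C)                  ≡⟨ +-congˡ (flow D f C) (∑-cnt Z (λ e → w D e C)) ⟨
    flow D f C + ∑ all (λ e → cnt Z e * w D e C)      ≡⟨ ∑-+ all _ _ ⟨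
    ∑ all (λ e → f e * w D e C + cnt Z e * w D e C)   ≡⟨ ∑-cong all (λ e → *-distribʳ-+ (w D e C) (f e) (cnt Z e)) ⟨
    flow D (λ e → f e + cnt Z e) C                    ∎
    where
    open ≤-Reasoning
    all = allFin (m D)
    capacity-≡ : ∀ C → capacity D f c C ≡ flow D f C + ∑ (copies c all) (λ e → ρ D e C)
    capacity-≡ C = trans (∑-+ all _ _) (+-congˡ (flow D f C) (sym (∑-copies c all (λ e → ρ D e C))))
    realized = realize (copies c all) (super-sub q (flow D f) sup (flow-submodular D f))
      (λ {C} d → ≤+⇒-≤ {q C} {flow D f C} (≤-trans (le d) (≤-reflexive (capacity-≡ C))))
    Z = proj₁ realized
    Z-real : ∀ {C} → 𝒟 C → q C - flow D f C ≤ ∑ Z (λ e → w D e C)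
    Z-real = proj₂ (proj₂ realized)
    bounds : ∀ e → f e ≤ f e + cnt Z e × f e + cnt Z e ≤ f e + + c e
    bounds e = 0≤⇒≤+ʳ (f e) (cnt-≥0 Z e)
             , +-monoʳ-≤ (f e) (≤-trans (∑-⊑ (proj₁ (proj₂ realized)) (λ j → 0≤ι _)) (≤-reflexive (cnt-copies c e)))

-- Integers inside the rationals, floors, and rational sums.

toℚᵘ-toℚ : ∀ a → toℚᵘ (toℚ a) ℚᵘ.≃ ℚᵘ.mkℚᵘ a 0
toℚᵘ-toℚ a = ℚ.toℚᵘ-fromℚᵘ (ℚᵘ.mkℚᵘ a 0)

toℚ-+ : ∀ a b → toℚ (a + b) ≡ toℚ a ℚ.+ toℚ b
toℚ-+ a b = ℚ.toℚᵘ-injective (begin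
  toℚᵘ (toℚ (a + b))                   ≈⟨ toℚᵘ-toℚ (a + b) ⟩
  ℚᵘ.mkℚᵘ (a + b) 0                    ≈⟨ ℚᵘ.*≡* (cong₂ (λ x y → (x + y) * 1ℤ)
    (sym (*-identityʳ a)) (sym (*-identityʳ b))) ⟩
  ℚᵘ.mkℚᵘ a 0 ℚᵘ.+ ℚᵘ.mkℚᵘ b 0         ≈⟨ ℚᵘ.+-cong (toℚᵘ-toℚ a) (toℚᵘ-toℚ b) ⟨
  toℚᵘ (toℚ a) ℚᵘ.+ toℚᵘ (toℚ b)       ≈⟨ ℚ.toℚᵘ-homo-+ (toℚ a) (toℚ b) ⟨
  toℚᵘ (toℚ a ℚ.+ toℚ b)               ∎)
  where open ℚᵘ.≃-Reasoning

toℚ-neg : ∀ a → toℚ (- a) ≡ ℚ.- toℚ a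
toℚ-neg a = ℚ.toℚᵘ-injective (begin
  toℚᵘ (toℚ (- a))     ≈⟨ toℚᵘ-toℚ (- a) ⟩
  ℚᵘ.- ℚᵘ.mkℚᵘ a 0     ≈⟨ ℚᵘ.-‿cong (toℚᵘ-toℚ a) ⟨
  ℚᵘ.- toℚᵘ (toℚ a)    ≈⟨ ℚ.toℚᵘ-homo‿- (toℚ a) ⟨
  toℚᵘ (ℚ.- toℚ a)     ∎)
  where open ℚᵘ.≃-Reasoning

toℚ-mono-≤ : ∀ {a b} → a ≤ b → toℚ a ℚ.≤ toℚ b
toℚ-mono-≤ {a} {b} a≤b = ℚ.toℚᵘ-cancel-≤
  (ℚᵘ.≤-respˡ-≃ (ℚᵘ.≃-sym (toℚᵘ-toℚ a)) (ℚᵘ.≤-respʳ-≃ (ℚᵘ.≃-sym (toℚᵘ-toℚ b))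
    (ℚᵘ.*≤* (*-monoʳ-≤-nonNeg 1ℤ a≤b))))

toℚ-cancel-< : ∀ {a b} → toℚ a ℚ.< toℚ b → a < b
toℚ-cancel-< {a} {b} h = *-cancelʳ-<-nonNeg 1ℤ (ℚᵘ.drop-*<*
  (ℚᵘ.<-respˡ-≃ (toℚᵘ-toℚ a) (ℚᵘ.<-respʳ-≃ (toℚᵘ-toℚ b) (ℚ.toℚᵘ-mono-< h))))

toℚ-cancel-≤ : ∀ {a b} → toℚ a ℚ.≤ toℚ b → a ≤ b
toℚ-cancel-≤ {a} {b} h = *-cancelʳ-≤-pos a b 1ℤ (ℚᵘ.drop-*≤*
  (ℚᵘ.≤-respˡ-≃ (toℚᵘ-toℚ a) (ℚᵘ.≤-respʳ-≃ (toℚᵘ-toℚ b) (ℚ.toℚᵘ-mono-≤ h))))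

floor : ℚ → ℤ
floor x = ↥ x /ℕ ↧ₙ x

floor-≤ : ∀ x → toℚ (floor x) ℚ.≤ x
floor-≤ x@record{} = ℚ.toℚᵘ-cancel-≤ (ℚᵘ.≤-respˡ-≃ (ℚᵘ.≃-sym (toℚᵘ-toℚ (floor x)))
  (ℚᵘ.*≤* (≤-trans ([n/ℕd]*d≤n (↥ x) (↧ₙ x)) (≤-reflexive (sym (*-identityʳ (↥ x)))))))

<-floor : ∀ x → x ℚ.< toℚ (1ℤ + floor x)
<-floor x@record{} = ℚ.toℚᵘ-cancel-< (ℚᵘ.<-respʳ-≃ (ℚᵘ.≃-sym (toℚᵘ-toℚ (1ℤ + floor x)))
  (ℚᵘ.*<* (≤-<-trans (≤-reflexive (*-identityʳ (↥ x))) (n<s[n/ℕd]*d (↥ x) (↧ₙ x)))))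

module _ {A : Set} where

  sumℚ-+ : (F G : A → ℚ) (xs : List A) →
           sumℚ (map (λ x → F x ℚ.+ G x) xs) ≡ sumℚ (map F xs) ℚ.+ sumℚ (map G xs)
  sumℚ-+ F G []       = sym (ℚ.+-identityˡ 0ℚ)
  sumℚ-+ F G (x ∷ xs) = trans (cong (F x ℚ.+ G x ℚ.+_) (sumℚ-+ F G xs))
                              (ℚ-interchange (F x) (G x) (sumℚ (map F xs)) (sumℚ (map G xs)))

  sumℚ-cong : {F G : A → ℚ} (xs : List A) → (∀ x → F x ≡ G x) → sumℚ (map F xs) ≡ sumℚ (map G xs)
  sumℚ-cong []       h = refl
  sumℚ-cong (x ∷ xs) h = cong₂ ℚ._+_ (h x) (sumℚ-cong xs h)

  sumℚ-mono : {F G : A → ℚ} (xs : List A) → (∀ x → F x ℚ.≤ G x) → sumℚ (map F xs) ℚ.≤ sumℚ (map G xs)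
  sumℚ-mono []       h = ℚ.≤-refl
  sumℚ-mono (x ∷ xs) h = ℚ.+-mono-≤ (h x) (sumℚ-mono xs h)

  sumℚ-0 : {F : A → ℚ} (xs : List A) → (∀ x → F x ≡ 0ℚ) → sumℚ (map F xs) ≡ 0ℚ
  sumℚ-0 []       h = refl
  sumℚ-0 (x ∷ xs) h = trans (cong₂ ℚ._+_ (h x) (sumℚ-0 xs h)) (ℚ.+-identityˡ 0ℚ)

  sumℚ-filter : (F : A → ℚ) (P : A → Bool) (xs : List A) →
                sumℚ (map F (filterᵇ P xs)) ≡ sumℚ (map (λ x → if P x then F x else 0ℚ) xs)
  sumℚ-filter F P []       = refl
  sumℚ-filter F P (x ∷ xs) with P x
  ... | true  = cong (F x ℚ.+_) (sumℚ-filter F P xs)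
  ... | false = trans (sumℚ-filter F P xs) (sym (ℚ.+-identityˡ _))

  sumℚ-toℚ : (F : A → ℤ) (xs : List A) → sumℚ (map (toℚ ∘ F) xs) ≡ toℚ (∑ xs F)
  sumℚ-toℚ F []       = refl
  sumℚ-toℚ F (x ∷ xs) = trans (cong (toℚ (F x) ℚ.+_) (sumℚ-toℚ F xs)) (sym (toℚ-+ (F x) (∑ xs F)))

  sumℚ-single : ∀ {k} (g : Fin k → A) (F : A → ℚ) i → (∀ j → j ≢ i → F (g j) ≡ 0ℚ) →
                sumℚ (map F (tabulate g)) ≡ F (g i)
  sumℚ-single {suc k} g F Fin.zero    h =
    trans (cong (F (g Fin.zero) ℚ.+_) (rest (g ∘ Fin.suc) λ j → h (Fin.suc j) λ ())) (ℚ.+-identityʳ _)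
    where
    rest : ∀ {k} (g : Fin k → A) → (∀ j → F (g j) ≡ 0ℚ) → sumℚ (map F (tabulate g)) ≡ 0ℚ
    rest {zero}  g h = refl
    rest {suc k} g h = trans (cong₂ ℚ._+_ (h Fin.zero) (rest (g ∘ Fin.suc) (h ∘ Fin.suc))) (ℚ.+-identityˡ 0ℚ)
  sumℚ-single {suc k} g F (Fin.suc i) h =
    trans (cong₂ ℚ._+_ (h Fin.zero λ ()) (sumℚ-single (g ∘ Fin.suc) F i λ j j≢i → h (Fin.suc j) λ { refl → j≢i refl }))
          (ℚ.+-identityˡ _)

-- Net in-flow of a set as a sum over edges.

-- The contribution of the value x of an edge whose head (resp. tail) satisfies h (resp. t)
-- to a net in-flow.
signed : ℚ → Bool → Bool → ℚ
signed x h t = (if h then x else 0ℚ) ℚ.+ (if t then ℚ.- x else 0ℚ)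

module _ (D : Digraph) where

  -- `ψ` with the list of edges as a parameter, which allows induction on that list in `sumℚ-netℚ`.
  netℚ : (Fin (m D) → ℚ) → List (Fin (m D)) → Fin (n D) → ℚ
  netℚ x es v = sumℚ (map x (filterᵇ (λ e → ⌊ hd D e Fin.≟ v ⌋) es))
            ℚ.- sumℚ (map x (filterᵇ (λ e → ⌊ tl D e Fin.≟ v ⌋) es))

  netℚ-∷ : ∀ x e es v → netℚ x (e ∷ es) v
           ≡ signed (x e) ⌊ hd D e Fin.≟ v ⌋ ⌊ tl D e Fin.≟ v ⌋ ℚ.+ netℚ x es v
  netℚ-∷ x e es v with ⌊ hd D e Fin.≟ v ⌋ | ⌊ tl D e Fin.≟ v ⌋
  ... | true  | true  = trans (cong (x e ℚ.+ a ℚ.+_) (ℚ.neg-distrib-+ (x e) b)) (ℚ-interchange (x e) a _ _)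
    where
    a = sumℚ (map x (filterᵇ (λ e → ⌊ hd D e Fin.≟ v ⌋) es))
    b = sumℚ (map x (filterᵇ (λ e → ⌊ tl D e Fin.≟ v ⌋) es))
  ... | true  | false = trans (ℚ.+-assoc (x e) _ _) (cong (ℚ._+ netℚ x es v) (sym (ℚ.+-identityʳ (x e))))
  ... | false | true  = trans (trans (cong (a ℚ.+_) (ℚ.neg-distrib-+ (x e) b))
      (trans (cong (ℚ._+ (ℚ.- x e ℚ.- b)) (sym (ℚ.+-identityˡ a))) (ℚ-interchange 0ℚ a (ℚ.- x e) (ℚ.- b)))) refl
    where
    a = sumℚ (map x (filterᵇ (λ e → ⌊ hd D e Fin.≟ v ⌋) es))
    b = sumℚ (map x (filterᵇ (λ e → ⌊ tl D e Fin.≟ v ⌋) es))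
  ... | false | false = trans (sym (ℚ.+-identityˡ _)) (cong (ℚ._+ netℚ x es v) (sym (ℚ.+-identityˡ 0ℚ)))

  sumℚ-point : ∀ (Z : Subset (n D)) (x : ℚ) u →
               sumℚ (map (λ v → if ⌊ u Fin.≟ v ⌋ then x else 0ℚ) (filterᵇ (isIn Z) (allFin (n D))))
               ≡ (if isIn Z u then x else 0ℚ)
  sumℚ-point Z x u = trans (sumℚ-filter F (isIn Z) (allFin (n D)))
    (trans (sumℚ-single id (λ v → if isIn Z v then F v else 0ℚ) u off) on)
    where
    F : Fin (n D) → ℚ
    F v = if ⌊ u Fin.≟ v ⌋ then x else 0ℚ
    off : ∀ v → v ≢ u → (if isIn Z v then F v else 0ℚ) ≡ 0ℚ
    off v v≢u with isIn Z v | u Fin.≟ v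
    ... | false | _     = refl
    ... | true  | yes p = contradiction (sym p) v≢u
    ... | true  | no _  = refl
    on : (if isIn Z u then F u else 0ℚ) ≡ (if isIn Z u then x else 0ℚ)
    on with u Fin.≟ u
    ... | yes _ = refl
    ... | no ¬p = contradiction refl ¬p

  sumℚ-netℚ : ∀ x (Z : Subset (n D)) es →
              sumℚ (map (netℚ x es) (filterᵇ (isIn Z) (allFin (n D))))
              ≡ sumℚ (map (λ e → signed (x e) (isIn Z (hd D e)) (isIn Z (tl D e))) es)
  sumℚ-netℚ x Z []       = sumℚ-0 (filterᵇ (isIn Z) (allFin (n D))) (λ _ → refl)
  sumℚ-netℚ x Z (e ∷ es) = trans (sumℚ-cong vs (netℚ-∷ x e es))
    (trans (sumℚ-+ _ (netℚ x es) vs) (cong₂ ℚ._+_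
      (trans (sumℚ-+ _ _ vs) (cong₂ ℚ._+_ (sumℚ-point Z (x e) (hd D e)) (sumℚ-point Z (ℚ.- x e) (tl D e))))
      (sumℚ-netℚ x Z es)))
    where vs = filterᵇ (isIn Z) (allFin (n D))

  tilde-ψ : ∀ x (Z : Subset (n D)) → tildeℚ D (ψ D x) Z ≡
            sumℚ (map (λ e → signed (x e) (isIn Z (hd D e)) (isIn Z (tl D e))) (allFin (m D)))
  tilde-ψ x Z = sumℚ-netℚ x Z (allFin (m D))

  signed-toℚ : ∀ a h t → signed (toℚ a) h t ≡ toℚ (a * (ι h - ι t))
  signed-toℚ a true  true  = trans (ℚ.+-inverseʳ (toℚ a)) (sym (cong toℚ (*-zeroʳ a)))
  signed-toℚ a true  false = trans (ℚ.+-identityʳ (toℚ a)) (sym (cong toℚ (*-identityʳ a)))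
  signed-toℚ a false true  = trans (ℚ.+-identityˡ _) (trans (sym (toℚ-neg a))
    (cong toℚ (trans (sym (-1*i≡-i a)) (*-comm (- 1ℤ) a))))
  signed-toℚ a false false = sym (cong toℚ (*-zeroʳ a))

  tilde-ψ-toℚ : ∀ (x : Fin (m D) → ℤ) Z →
                tildeℚ D (ψ D (toℚ ∘ x)) Z ≡ toℚ (∑ (allFin (m D)) (λ e → x e * w D e Z))
  tilde-ψ-toℚ x Z = trans (tilde-ψ (toℚ ∘ x) Z)
    (trans (sumℚ-cong (allFin (m D)) (λ e → signed-toℚ (x e) (isIn Z (hd D e)) (isIn Z (tl D e))))
           (sumℚ-toℚ (λ e → x e * w D e Z) (allFin (m D))))

isIn-⊤ : ∀ {k} (v : Fin k) → isIn ⊤ v ≡ true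
isIn-⊤ v = trans (isIn-lookup ⊤ v) (lookup-replicate v true)

-- Integral net in-flow split into entering and leaving edges.

module _ (D : Digraph) where

  private all = allFin (m D)

  w-split : ∀ e C → w D e C ≡ ι (enters D C e) - ι (leaves D C e)
  w-split e C = toWitness {a? = ∀Bool? λ a → ∀Bool? λ b → ι a - ι b ≟ ι (a ∧ not b) - ι (b ∧ not a)}
                          _ (isIn C (hd D e)) (isIn C (tl D e))

  flow-split : ∀ x C → flow D x C ≡ ∑ (filterᵇ (enters D C) all) x - ∑ (filterᵇ (leaves D C) all) x
  flow-split x C = begin
    flow D x C
      ≡⟨ ∑-cong all (λ e → trans (cong (λ z → x e * z) (w-split e C)) (distrib (x e) (ι (enters D C e)) _)) ⟩
    ∑ all (λ e → ι (enters D C e) * x e - ι (leaves D C e) * x e)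
      ≡⟨ ∑-minus all _ _ ⟩
    ∑ all (λ e → ι (enters D C e) * x e) - ∑ all (λ e → ι (leaves D C e) * x e)
      ≡⟨ cong₂ _-_ (∑-filter (enters D C) all x) (∑-filter (leaves D C) all x) ⟨
    ∑ (filterᵇ (enters D C) all) x - ∑ (filterᵇ (leaves D C) all) x ∎
    where
    open ≡-Reasoning
    distrib : ∀ x a b → x * (a - b) ≡ a * x - b * x
    distrib = solve-∀

  flow-⊤ : ∀ x → flow D x ⊤ ≡ 0ℤ
  flow-⊤ x = trans (∑-cong all vanish) (∑-0 all)
    where
    vanish : ∀ e → x e * w D e ⊤ ≡ 0ℤ
    vanish e rewrite isIn-⊤ (hd D e) | isIn-⊤ (tl D e) = *-zeroʳ (x e)

-- Integral flows and weak duality.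

module BaseFlow (D : Digraph) (f g : Fin (m D) → Maybe ℤ) (p : Subset (n D) → Maybe ℤ) where

  private all = allFin (m D)

  -- `InQℤ` restated over ℤ. The equation at `⊤` is recovered in `IsFlow⇒InQℤ` from `flow-⊤`: no
  -- edge crosses the boundary of V.
  record IsFlow (x : Fin (m D) → ℤ) : Set where
    field
      lower : ∀ e {a} → f e ≡ just a → a ≤ x e
      upper : ∀ e {b} → g e ≡ just b → x e ≤ b
      cuts  : ∀ {C a} → p C ≡ just a → a ≤ flow D x C

  open IsFlow

  InQℤ⇒IsFlow : ∀ {x} → InQℤ D f g p x → IsFlow x
  InQℤ⇒IsFlow {x} (lo , up , _ , cut≤) = record
    { lower = λ e eq → toℚ-cancel-≤ (lo e _ eq)
    ; upper = λ e eq → toℚ-cancel-≤ (up e _ eq)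
    ; cuts  = λ {C} {a} eq → toℚ-cancel-≤ (subst (toℚ a ℚ.≤_) (tilde-ψ-toℚ D x C) (cut≤ C _ eq))
    }

  IsFlow⇒InQℤ : p ⊤ ≡ just 0ℤ → ∀ {x} → IsFlow x → InQℤ D f g p x
  IsFlow⇒InQℤ p⊤ {x} q =
      (λ e a eq → toℚ-mono-≤ (lower q e eq))
    , (λ e b eq → toℚ-mono-≤ (upper q e eq))
    , (λ a eq → trans (tilde-ψ-toℚ D x ⊤) (cong toℚ (trans (flow-⊤ D x) (just-injective (trans (sym p⊤) eq)))))
    , (λ C a eq → subst (toℚ a ℚ.≤_) (sym (tilde-ψ-toℚ D x C)) (toℚ-mono-≤ (cuts q eq)))

  term-just⁻ : ∀ C {s} → term D f g p C ≡ just s → ∃ λ a → ∃ λ b → ∃ λ c →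
               ϱ D g C ≡ just a × δ D f C ≡ just b × p C ≡ just c × s ≡ a + (- b + - c)
  term-just⁻ C eq with ϱ D g C | δ D f C | p C
  term-just⁻ C refl | just a | just b | just c = a , b , c , refl , refl , refl , refl

  chainValue-just⁻ : ∀ L cs {v} → chainValue D f g p L cs ≡ just v →
                     ∃ λ k → chainSum D f g p cs ≡ just k × v ≡ + ϱL D L cs - k
  chainValue-just⁻ L cs eq with chainSum D f g p cs
  chainValue-just⁻ L cs refl | just k = k , refl , refl

  chainValue-just : ∀ L cs {k} → chainSum D f g p cs ≡ just k →
                    chainValue D f g p L cs ≡ just (+ ϱL D L cs - k)
  chainValue-just L cs eq with chainSum D f g p cs
  chainValue-just L cs refl | just k = refl

  module _ (L : Subset (m D)) {x : Fin (m D) → ℤ} (q : IsFlow x) where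

    below : Fin (m D) → ℤ
    below e = ι (isIn L e ∧ not (atUpper D g x e))

    -- Integrality of x enters here: an upper bound that is not attained is missed by at least 1.
    x+below≤g : ∀ e b → g e ≡ just b → x e + below e ≤ b
    x+below≤g e b eq with isIn L e
    ... | false = subst (_≤ b) (sym (+-identityʳ (x e))) (upper q e eq)
    ... | true rewrite eq with x e ℤ.≟ b
    ...   | yes x≡b = ≤-trans (≤-reflexive (+-identityʳ (x e))) (≤-reflexive x≡b)
    ...   | no  x≢b = subst (_≤ b) (+-comm 1ℤ (x e)) (i<j⇒suc[i]≤j (≤∧≢⇒< (upper q e eq) x≢b))

    -- The bracket of C dominates the sum of the slacks g - x on entering edges, x - f on leaving
    -- edges, and net in-flow minus p C. The first group alone has one unit for every entering edge
    -- of L below its bound.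
    term-≥ : ∀ C s → term D f g p C ≡ just s → ∑ all (λ e → below e * ρ D e C) ≤ s
    term-≥ C s eq with term-just⁻ C eq
    ... | a , b , c , ϱ≡a , δ≡b , p≡c , refl = ≤-trans (≤-reflexive
      (trans (∑-cong all (λ e → *-comm (below e) (ρ D e C))) (sym (∑-filter (enters D C) all below))))
      (combine (∑ ent below) (∑ ent x) (∑ lea x) a b c
        (≤-trans (≤-reflexive (sym (∑-+ ent x below))) (sumE-≥ x+below≤g ent ϱ≡a))
        (sumE-≤ (λ e a → lower q e) lea δ≡b)
        (≤-trans (cuts q p≡c) (≤-reflexive (flow-split D x C))))
      where
      ent = filterᵇ (enters D C) all
      lea = filterᵇ (leaves D C) all
      combine : ∀ u y z a b c → y + u ≤ a → b ≤ z → c ≤ y - z → u ≤ a + (- b + - c)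
      combine u y z a b c h₁ h₂ h₃ = ≤-from (+-mono-≤ h₁ (+-mono-≤ h₂ h₃)) (balance-eq u y z a b c)
        where
        balance-eq : ∀ u y z a b c → a + (- b + - c) - u ≡ a + (z + (y - z)) - (y + u + (b + c))
        balance-eq = solve-∀

    -- A covered edge of L is either at its upper bound, and counted, or below it, and then
    -- contributes a unit to the bracket of each member it enters. Exchanging the sums over edges
    -- and members charges the second kind to the brackets.
    weak-duality : ∀ cs v → chainValue D f g p L cs ≡ just v → v ≤ + countUpper D g L x
    weak-duality cs v eq with chainValue-just⁻ L cs eq
    ... | k , sum≡k , refl = ≤-trans (+-mono-≤ ϱL-≤ (neg-mono-≤ k-≥))
      (≤-reflexive (cancel _ (∑ all (λ e → below e * ι (covered D e cs)))))
      where
      open ≤-Reasoning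
      cancel : ∀ a b → a + b - b ≡ a
      cancel = solve-∀
      k-≥ : ∑ all (λ e → below e * ι (covered D e cs)) ≤ k
      k-≥ = begin
        ∑ all (λ e → below e * ι (covered D e cs))
          ≤⟨ ∑-mono all (λ e → below-mono e (ι-any-≤ (λ C → enters D C e) cs)) ⟩
        ∑ all (λ e → below e * ∑ cs (ρ D e))
          ≡⟨ ∑-cong all (λ e → ∑-* cs (below e) (ρ D e)) ⟨
        ∑ all (λ e → ∑ cs (λ C → below e * ρ D e C))
          ≡⟨ ∑-swap all cs _ ⟩
        ∑ cs (λ C → ∑ all (λ e → below e * ρ D e C))
          ≤⟨ sumE-≥ term-≥ cs sum≡k ⟩
        k ∎
        where
        below-mono : ∀ e {a b} → a ≤ b → below e * a ≤ below e * b
        below-mono e a≤b with isIn L e ∧ not (atUpper D g x e)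
        ... | true  = *-monoˡ-≤-nonNeg 1ℤ a≤b
        ... | false = ≤-refl
      split : ∀ l u c → ι (l ∧ c) ≤ ι (l ∧ u) + ι (l ∧ not u) * ι c
      split = toWitness {a? = ∀Bool? λ l → ∀Bool? λ u → ∀Bool? λ c →
                              ι (l ∧ c) ≤? ι (l ∧ u) + ι (l ∧ not u) * ι c} _
      ϱL-≤ : + ϱL D L cs ≤ + countUpper D g L x + ∑ all (λ e → below e * ι (covered D e cs))
      ϱL-≤ = begin
        + ϱL D L cs
          ≡⟨ length-filter-∑ _ all ⟩
        ∑ all (λ e → ι (isIn L e ∧ covered D e cs))
          ≤⟨ ∑-mono all (λ e → split (isIn L e) (atUpper D g x e) (covered D e cs)) ⟩
        ∑ all (λ e → ι (isIn L e ∧ atUpper D g x e) + below e * ι (covered D e cs))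
          ≡⟨ ∑-+ all _ _ ⟩
        ∑ all (λ e → ι (isIn L e ∧ atUpper D g x e)) + ∑ all (λ e → below e * ι (covered D e cs))
          ≡⟨ +-congʳ (∑ all (λ e → below e * ι (covered D e cs))) (length-filter-∑ _ all) ⟨
        + countUpper D g L x + ∑ all (λ e → below e * ι (covered D e cs)) ∎

-- Strong duality.

module Duality (D : Digraph) (f g : Fin (m D) → Maybe ℤ) (p : Subset (n D) → Maybe ℤ)
               (super : ∀ X Y a b → p X ≡ just a → p Y ≡ just b →
                  Σ ℤ λ c → Σ ℤ λ d → (p (X ∩ Y) ≡ just c) × (p (X ∪ Y) ≡ just d) × (a + b ≤ c + d)) where

  open BaseFlow D f g p

  private all = allFin (m D)

  Finite : Subset (n D) → Set
  Finite C = ∃ λ a → p C ≡ just a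

  finite? : Decidable Finite
  finite? C with p C
  ... | just a  = yes (a , refl)
  ... | nothing = no λ ()

  finite-∩ : ∀ {X Y} → Finite X → Finite Y → Finite (X ∩ Y)
  finite-∩ {X} {Y} (a , pX) (b , pY) = let (c , _ , p∩ , _) = super X Y a b pX pY in c , p∩

  finite-∪ : ∀ {X Y} → Finite X → Finite Y → Finite (X ∪ Y)
  finite-∪ {X} {Y} (a , pX) (b , pY) = let (_ , d , _ , p∪ , _) = super X Y a b pX pY in d , p∪

  open Lattice D Finite finite? finite-∩ finite-∪

  p₀ : Subset (n D) → ℤ
  p₀ C = fromMaybe 0ℤ (p C)

  p₀-just : ∀ {C a} → p C ≡ just a → p₀ C ≡ a
  p₀-just eq = cong (fromMaybe 0ℤ) eq

  p₀-supermodular : Supermodular p₀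
  p₀-supermodular {X} {Y} (a , pX) (b , pY) = let (c , d , p∩ , p∪ , le) = super X Y a b pX pY in
    subst₂ _≤_ (sym (cong₂ _+_ (p₀-just pX) (p₀-just pY)))
               (sym (cong₂ _+_ (p₀-just p∩) (p₀-just p∪))) le

  -- Rounding x₀ down and up gives bounds that respect f and g, because these are integral. Since x₀
  -- lies between the new bounds, it witnesses the capacity condition of `integral-flow`.
  integral-point : (∃ λ x₀ → InQ D f g p x₀) → ∃ IsFlow
  integral-point (x₀ , lo , up , _ , cut≤) = x , record
    { lower = λ e {a} eq → ≤-trans (below-floor e (lo e a eq)) (proj₁ (bounds e))
    ; upper = λ e {b} eq → ≤-trans (proj₂ (bounds e)) (above-ceil e (up e b eq))
    ; cuts  = λ {C} {a} eq → subst (_≤ flow D x C) (p₀-just eq) (x-cuts (a , eq))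
    }
    where
    lo₀ : Fin (m D) → ℤ
    lo₀ e = floor (x₀ e)

    frac : ∀ (y : ℚ) → Dec (y ≡ toℚ (floor y)) → ℕ
    frac y (yes _) = 0
    frac y (no _)  = 1

    c : Fin (m D) → ℕ
    c e = frac (x₀ e) (x₀ e ℚ.≟ toℚ (lo₀ e))

    below-floor : ∀ e {a} → toℚ a ℚ.≤ x₀ e → a ≤ lo₀ e
    below-floor e {a} le = drop-suc {a} {lo₀ e}
      (i<j⇒suc[i]≤j (toℚ-cancel-< {a} {1ℤ + lo₀ e} (ℚ.≤-<-trans le (<-floor (x₀ e)))))
      where
      drop-suc : ∀ {a b} → 1ℤ + a ≤ 1ℤ + b → a ≤ b
      drop-suc {a} {b} h = ≤-from h (balance-eq a b)
        where
        balance-eq : ∀ a b → b - a ≡ 1ℤ + b - (1ℤ + a)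
        balance-eq = solve-∀

    x₀≤lo₀+c : ∀ e → x₀ e ℚ.≤ toℚ (lo₀ e + + c e)
    x₀≤lo₀+c e with x₀ e ℚ.≟ toℚ (lo₀ e)
    ... | yes eq = ℚ.≤-reflexive (trans eq (cong toℚ (sym (+-identityʳ (lo₀ e)))))
    ... | no _   = subst (λ z → x₀ e ℚ.≤ toℚ z) (+-comm 1ℤ (lo₀ e)) (ℚ.<⇒≤ (<-floor (x₀ e)))

    above-ceil : ∀ e {b} → x₀ e ℚ.≤ toℚ b → lo₀ e + + c e ≤ b
    above-ceil e {b} le with x₀ e ℚ.≟ toℚ (lo₀ e)
    ... | yes eq = subst (_≤ b) (sym (+-identityʳ (lo₀ e))) (toℚ-cancel-≤ (subst (ℚ._≤ toℚ b) eq le))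
    ... | no neq = subst (_≤ b) (+-comm 1ℤ (lo₀ e)) (i<j⇒suc[i]≤j (toℚ-cancel-< {lo₀ e} {b}
                     (ℚ.<-≤-trans (ℚ.≰⇒> (λ ge → neq (ℚ.≤-antisym ge (floor-≤ (x₀ e))))) le)))

    signed-≤ : ∀ y l (c : ℕ) → toℚ l ℚ.≤ y → y ℚ.≤ toℚ (l + + c) → ∀ h t →
               signed y h t ℚ.≤ toℚ (l * (ι h - ι t) + + c * ι (h ∧ not t))
    signed-≤ y l c l≤y y≤l+c true  true  rewrite *-zeroʳ l | *-zeroʳ (+ c) = ℚ.≤-reflexive (ℚ.+-inverseʳ y)
    signed-≤ y l c l≤y y≤l+c true  false = ℚ.≤-trans (ℚ.≤-reflexive (ℚ.+-identityʳ y))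
      (ℚ.≤-trans y≤l+c (ℚ.≤-reflexive (cong toℚ (sym (cong₂ _+_ (*-identityʳ l) (*-identityʳ (+ c)))))))
    signed-≤ y l c l≤y y≤l+c false true  = ℚ.≤-trans (ℚ.≤-reflexive (ℚ.+-identityˡ (ℚ.- y)))
      (ℚ.≤-trans (ℚ.neg-antimono-≤ l≤y) (ℚ.≤-reflexive (trans (sym (toℚ-neg l)) (cong toℚ (neg-one l (+ c))))))
      where
      neg-one : ∀ l c → - l ≡ l * (0ℤ - 1ℤ) + c * 0ℤ
      neg-one = solve-∀
    signed-≤ y l c l≤y y≤l+c false false rewrite *-zeroʳ l | *-zeroʳ (+ c) = ℚ.≤-refl

    p₀≤capacity : ∀ {C} → Finite C → p₀ C ≤ capacity D lo₀ c C
    p₀≤capacity {C} (a , eq) = toℚ-cancel-≤ (begin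
      toℚ (p₀ C)           ≡⟨ cong toℚ (p₀-just eq) ⟩
      toℚ a                ≤⟨ cut≤ C a eq ⟩
      tildeℚ D (ψ D x₀) C  ≡⟨ tilde-ψ D x₀ C ⟩
      _                    ≤⟨ sumℚ-mono all (λ e → signed-≤ (x₀ e) (lo₀ e) (c e) (floor-≤ (x₀ e)) (x₀≤lo₀+c e)
                                (isIn C (hd D e)) (isIn C (tl D e))) ⟩
      _                    ≡⟨ sumℚ-toℚ _ all ⟩
      toℚ (capacity D lo₀ c C) ∎)
      where open ℚ.≤-Reasoning

    rounded = integral-flow lo₀ c p₀-supermodular p₀≤capacity
    x = proj₁ rounded
    bounds = proj₁ (proj₂ rounded)
    x-cuts : ∀ {C} → Finite C → p₀ C ≤ flow D x C
    x-cuts = proj₂ (proj₂ rounded)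

  -- Infinite bounds are replaced by bounds at distance K from a feasible flow x. No set of
  -- a chain of nonnegative value meets an edge whose bound was replaced, as K exceeds |L|.
  module Strong (L : Subset (m D)) (goodL : GoodL D f g L) {x : Fin (m D) → ℤ} (x-flow : IsFlow x) where

    open IsFlow

    K : ℤ
    K = + suc (m D)

    f₀ g₀ : Fin (m D) → ℤ
    f₀ e = fromMaybe (x e - K) (f e)
    g₀ e = fromMaybe (x e + K) (g e)

    f₀-just : ∀ {e a} → f e ≡ just a → f₀ e ≡ a
    f₀-just {e} eq = cong (fromMaybe (x e - K)) eq

    g₀-just : ∀ {e b} → g e ≡ just b → g₀ e ≡ b
    g₀-just {e} eq = cong (fromMaybe (x e + K)) eq

    sub-sub : ∀ a k → a - (a - k) ≡ k
    sub-sub = solve-∀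

    add-sub : ∀ a k → a + k - a ≡ k
    add-sub = solve-∀

    f₀-or-far : ∀ e → f e ≡ just (f₀ e) ⊎ K ≤ x e - f₀ e
    f₀-or-far e with f e
    ... | just a  = inj₁ refl
    ... | nothing = inj₂ (≤-reflexive (sym (sub-sub (x e) K)))

    g₀-or-far : ∀ e → g e ≡ just (g₀ e) ⊎ K ≤ g₀ e - x e
    g₀-or-far e with g e
    ... | just b  = inj₁ refl
    ... | nothing = inj₂ (≤-reflexive (sym (add-sub (x e) K)))

    f₀≤x : ∀ e → 0ℤ ≤ x e - f₀ e
    f₀≤x e with f₀-or-far e
    ... | inj₁ eq  = i≤j⇒0≤j-i (lower x-flow e eq)
    ... | inj₂ far = ≤-trans (+≤+ z≤n) far

    x≤g₀ : ∀ e → 0ℤ ≤ g₀ e - x e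
    x≤g₀ e with g₀-or-far e
    ... | inj₁ eq  = i≤j⇒0≤j-i (upper x-flow e eq)
    ... | inj₂ far = ≤-trans (+≤+ z≤n) far

    ℓ : Fin (m D) → ℤ
    ℓ e = ι (isIn L e)

    f₀+ℓ≤g₀ : ∀ e → f₀ e + ℓ e ≤ g₀ e
    f₀+ℓ≤g₀ e with isIn L e in e∈L
    ... | true  with goodL e e∈L
    ...   | a , b , fe , ge , a<b = subst₂ (λ y z → y + 1ℤ ≤ z) (sym (f₀-just fe)) (sym (g₀-just ge))
                                      (subst (_≤ b) (+-comm 1ℤ a) (i<j⇒suc[i]≤j a<b))
    f₀+ℓ≤g₀ e | false = ≤-trans (≤-reflexive (+-identityʳ (f₀ e)))
      (≤-trans (0≤i-j⇒j≤i (f₀≤x e)) (0≤i-j⇒j≤i (x≤g₀ e)))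

    -- The room between `f₀` and `g₀` lowered by 1 on L: a flow within it attains no upper bound on
    -- L.
    c : Fin (m D) → ℕ
    c e = ℤ.∣ g₀ e - (f₀ e + ℓ e) ∣

    +c : ∀ e → + c e ≡ g₀ e - (f₀ e + ℓ e)
    +c e = 0≤i⇒+∣i∣≡i (i≤j⇒0≤j-i (f₀+ℓ≤g₀ e))

    -- The demand of C left unmet when no edge of L may attain its upper bound. Written through
    -- `capacity` its supermodularity is immediate; `capacity-ℓ` and `h≡ρ-s` recover the formula by
    -- entering and leaving edges.
    h : Subset (n D) → ℤ
    h C = p₀ C - capacity D f₀ c C

    h-supermodular : Supermodular h
    h-supermodular = super-sub p₀ (capacity D f₀ c) p₀-supermodular (capacity-submodular D f₀ c)

    Ls : List (Fin (m D))
    Ls = filterᵇ (isIn L) all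

    entering leaving : Subset (n D) → List (Fin (m D))
    entering C = filterᵇ (enters D C) all
    leaving  C = filterᵇ (leaves D C) all

    s : Subset (n D) → ℤ
    s C = ∑ (entering C) g₀ + (- ∑ (leaving C) f₀ + - p₀ C)

    -- The flow x cancels from the right-hand side. It is there to show that the bracket `s` is a
    -- sum of slacks, hence nonnegative and large as soon as one slack is large.
    s≡slacks : ∀ C → s C ≡ ∑ (entering C) (λ e → g₀ e - x e) + ∑ (leaving C) (λ e → x e - f₀ e)
                           + (flow D x C - p₀ C)
    s≡slacks C = sym (trans
      (cong₂ _+_ (cong₂ _+_ (∑-minus (entering C) g₀ x) (∑-minus (leaving C) x f₀))
                 (cong (λ z → z - p₀ C) (flow-split D x C)))
      (collect (∑ (entering C) g₀) (∑ (entering C) x) (∑ (leaving C) x) (∑ (leaving C) f₀) (p₀ C)))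
      where
      collect : ∀ a b c d q → a - b + (c - d) + (b - c - q) ≡ a + (- d + - q)
      collect = solve-∀

    entering-slack≥0 : ∀ C → 0ℤ ≤ ∑ (entering C) (λ e → g₀ e - x e)
    entering-slack≥0 C = ∑-nonneg (entering C) x≤g₀

    leaving-slack≥0 : ∀ C → 0ℤ ≤ ∑ (leaving C) (λ e → x e - f₀ e)
    leaving-slack≥0 C = ∑-nonneg (leaving C) f₀≤x

    cut-slack≥0 : ∀ {C} → Finite C → 0ℤ ≤ flow D x C - p₀ C
    cut-slack≥0 {C} (a , eq) = i≤j⇒0≤j-i (subst (_≤ flow D x C) (sym (p₀-just eq)) (cuts x-flow eq))

    s≥0 : ∀ {C} → Finite C → 0ℤ ≤ s C
    s≥0 {C} d = ≤-trans (+-mono-≤ (+-mono-≤ (entering-slack≥0 C) (leaving-slack≥0 C)) (cut-slack≥0 d))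
                        (≤-reflexive (sym (s≡slacks C)))

    term-or-far : ∀ {C} → Finite C → term D f g p C ≡ just (s C) ⊎ K ≤ s C
    term-or-far {C} d@(a , eq)
      with sumE-finite-or-large g₀-or-far x≤g₀ (entering C) | sumE-finite-or-large f₀-or-far f₀≤x (leaving C)
    ... | inj₁ u | inj₁ v = inj₁ (cong₂ _⊕_ u (cong₂ _⊕_ (cong negE v)
                              (trans (cong negE eq) (cong (λ z → just (- z)) (sym (p₀-just eq))))))
    ... | inj₂ u | _ = inj₂ (≤-trans u (≤-trans (0≤⇒≤+ʳ _ (leaving-slack≥0 C))
                              (≤-trans (0≤⇒≤+ʳ _ (cut-slack≥0 d)) (≤-reflexive (sym (s≡slacks C))))))
    ... | inj₁ _ | inj₂ v = inj₂ (≤-trans v (≤-trans (0≤⇒≤+ˡ _ (entering-slack≥0 C))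
                              (≤-trans (0≤⇒≤+ʳ _ (cut-slack≥0 d)) (≤-reflexive (sym (s≡slacks C))))))

    capacity-ℓ : ∀ C → capacity D f₀ c C + ∑ Ls (λ e → ρ D e C) ≡ ∑ (entering C) g₀ - ∑ (leaving C) f₀
    capacity-ℓ C = begin
      capacity D f₀ c C + ∑ Ls (λ e → ρ D e C)
        ≡⟨ +-congˡ (capacity D f₀ c C) (∑-filter (isIn L) all _) ⟩
      capacity D f₀ c C + ∑ all (λ e → ℓ e * ρ D e C)
        ≡⟨ ∑-+ all _ _ ⟨
      ∑ all (λ e → f₀ e * w D e C + + c e * ρ D e C + ℓ e * ρ D e C)
        ≡⟨ ∑-cong all (λ e → trans
             (cong₂ (λ y z → f₀ e * y + z * ρ D e C + ℓ e * ρ D e C) (w-split D e C) (+c e))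
             (regroup-edge (f₀ e) (g₀ e) (ℓ e) (ρ D e C) (ι (leaves D C e)))) ⟩
      ∑ all (λ e → ρ D e C * g₀ e - ι (leaves D C e) * f₀ e)
        ≡⟨ ∑-minus all _ _ ⟩
      ∑ all (λ e → ρ D e C * g₀ e) - ∑ all (λ e → ι (leaves D C e) * f₀ e)
        ≡⟨ cong₂ _-_ (∑-filter (enters D C) all g₀) (∑-filter (leaves D C) all f₀) ⟨
      ∑ (entering C) g₀ - ∑ (leaving C) f₀ ∎
      where
      open ≡-Reasoning
      regroup-edge : ∀ f g l r q → f * (r - q) + (g - (f + l)) * r + l * r ≡ r * g - q * f
      regroup-edge = solve-∀

    h≡ρ-s : ∀ C → h C ≡ ∑ Ls (λ e → ρ D e C) - s C
    h≡ρ-s C = solve-for (p₀ C) (∑ Ls (λ e → ρ D e C)) (∑ (entering C) g₀) (∑ (leaving C) f₀) (capacity-ℓ C)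
      where
      solve-for : ∀ q r a b {k} → k + r ≡ a - b → q - k ≡ r - (a + (- b + - q))
      solve-for q r a b {k} eq = trans (lhs q r k) (trans (cong (λ z → q + r - z) eq) (rhs q r a b))
        where
        lhs : ∀ q r k → q - k ≡ q + r - (k + r)
        lhs = solve-∀
        rhs : ∀ q r a b → q + r - (a - b) ≡ r - (a + (- b + - q))
        rhs = solve-∀

    h≤ρ : ∀ {C} → Finite C → h C ≤ ∑ Ls (λ e → ρ D e C)
    h≤ρ {C} d = drop-nonneg {s C} (s≥0 d) (≤-reflexive (h≡ρ-s C))

    module FromCover (cov : Cover Ls h) where

      open Cover cov

      -- The edges of Z get back the unit that `c` withholds on L.
      c' : Fin (m D) → ℕ
      c' e = c e ℕ.+ ℤ.∣ cnt Z e ∣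

      +c' : ∀ e → + c' e ≡ + c e + cnt Z e
      +c' e = +-congˡ (+ c e) (0≤i⇒+∣i∣≡i (cnt-≥0 Z e))

      p₀≤capacity' : ∀ {C} → Finite C → p₀ C ≤ capacity D f₀ c' C
      p₀≤capacity' {C} d = begin
        p₀ C
          ≤⟨ -≤⇒≤+ {p₀ C} {capacity D f₀ c C} (covers d) ⟩
        capacity D f₀ c C + ∑ Z (λ e → ρ D e C)
          ≡⟨ +-congˡ (capacity D f₀ c C) (∑-cnt Z (λ e → ρ D e C)) ⟨
        capacity D f₀ c C + ∑ all (λ e → cnt Z e * ρ D e C)
          ≡⟨ ∑-+ all _ _ ⟨
        ∑ all (λ e → f₀ e * w D e C + + c e * ρ D e C + cnt Z e * ρ D e C)
          ≡⟨ ∑-cong all (λ e → trans (factor (f₀ e * w D e C) (+ c e) (cnt Z e) (ρ D e C))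
               (cong (λ z → f₀ e * w D e C + z * ρ D e C) (sym (+c' e)))) ⟩
        capacity D f₀ c' C ∎
        where
        open ≤-Reasoning
        factor : ∀ a b c r → a + b * r + c * r ≡ a + (b + c) * r
        factor = solve-∀

      module FromFlow {y : Fin (m D) → ℤ} (bounds : ∀ e → f₀ e ≤ y e × y e ≤ f₀ e + + c' e)
                      (y-cuts : ∀ {C} → Finite C → p₀ C ≤ flow D y C) where

        f₀≤y : ∀ e → f₀ e ≤ y e
        f₀≤y e = proj₁ (bounds e)

        y≤g₀-ℓ+cnt : ∀ e → y e ≤ g₀ e - ℓ e + cnt Z e
        y≤g₀-ℓ+cnt e = ≤-trans (proj₂ (bounds e)) (≤-reflexive
          (trans (+-congˡ (f₀ e) (trans (+c' e) (+-congʳ (cnt Z e) (+c e)))) (assemble (f₀ e) (g₀ e) (ℓ e) (cnt Z e))))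
          where
          assemble : ∀ f g l z → f + (g - (f + l) + z) ≡ g - l + z
          assemble = solve-∀

        -- Z is a sublist of `Ls`, in which each edge of L occurs exactly once.
        cnt-Z≤ℓ : ∀ e → cnt Z e ≤ ℓ e
        cnt-Z≤ℓ e = ≤-trans (∑-⊑ Z⊑L (λ j → 0≤ι _)) (≤-reflexive (cnt-filter (isIn L) e))

        y-flow : IsFlow y
        y-flow = record
          { lower = λ e {a} eq → subst (_≤ y e) (f₀-just eq) (f₀≤y e)
          ; upper = λ e {b} eq → subst (y e ≤_) (g₀-just eq) (≤-trans (y≤g₀-ℓ+cnt e) (drop-room (g₀ e) (cnt-Z≤ℓ e)))
          ; cuts  = λ {C} {a} eq → subst (_≤ flow D y C) (p₀-just eq) (y-cuts (a , eq))
          }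
          where
          drop-room : ∀ g {l z} → z ≤ l → g - l + z ≤ g
          drop-room g {l} {z} le = ≤-from le (balance-eq g l z)
            where
            balance-eq : ∀ g l z → g - (g - l + z) ≡ l - z
            balance-eq = solve-∀

        upper-in-Z : ∀ e → ι (isIn L e ∧ atUpper D g y e) ≤ cnt Z e
        upper-in-Z e with isIn L e | y≤g₀-ℓ+cnt e
        ... | false | _     = cnt-≥0 Z e
        ... | true  | bound with g e
        ...   | nothing = cnt-≥0 Z e
        ...   | just b with y e ℤ.≟ b
        ...     | no _    = cnt-≥0 Z e
        ...     | yes y≡b = saturated b (subst (_≤ b - 1ℤ + cnt Z e) y≡b bound)
          where
          saturated : ∀ b {z} → b ≤ b - 1ℤ + z → 1ℤ ≤ z
          saturated b {z} le = ≤-from le (balance-eq b z)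
            where
            balance-eq : ∀ b z → z - 1ℤ ≡ b - 1ℤ + z - b
            balance-eq = solve-∀

        count≤∣Z∣ : + countUpper D g L y ≤ + length Z
        count≤∣Z∣ = begin
          + countUpper D g L y                          ≡⟨ length-filter-∑ _ all ⟩
          ∑ all (λ e → ι (isIn L e ∧ atUpper D g y e))  ≤⟨ ∑-mono all upper-in-Z ⟩
          ∑ all (cnt Z)                                 ≡⟨ ∑-cong all (λ e → *-identityʳ (cnt Z e)) ⟨
          ∑ all (λ e → cnt Z e * 1ℤ)                    ≡⟨ ∑-cnt Z (λ _ → 1ℤ) ⟩
          ∑ Z (λ _ → 1ℤ)                                ≡⟨ ∑-1 Z ⟩
          + length Z                                    ∎
          where open ≤-Reasoning

        -- Uncrossing turns the optimal family into an increasing chain; repetitions are then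
        -- removed, since they do not change the covered edges and s ≥ 0.
        chain : List (Subset (n D))
        chain = dedup (uncross cs)

        chain-finite : All Finite chain
        chain-finite = dedup-All (uncross-𝒟 cs⊆𝒟)

        isChain : IsChain D chain
        isChain = AllPairs⇒Linked (dedup-⊂ (uncross-chain cs))

        ϱL-chain : ∑ Ls (λ e → ι (covered D e chain)) ≡ + ϱL D L chain
        ϱL-chain = trans (∑-filter (isIn L) all _) (trans
          (∑-cong all (λ e → ι-∧ (isIn L e) (covered D e chain))) (sym (length-filter-∑ _ all)))
          where
          ι-∧ : ∀ a b → ι a * ι b ≡ ι (a ∧ b)
          ι-∧ true  b = *-identityˡ (ι b)
          ι-∧ false b = refl

        ∣Z∣≤ϱ-s : + length Z ≤ + ϱL D L chain - ∑ chain s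
        ∣Z∣≤ϱ-s = begin
          + length Z
            ≤⟨ strong ⟩
          ∑ cs h - ∑ Ls (λ e → cut (t D e cs))
            ≤⟨ +-monoˡ-≤ _ (uncross-∑ h-supermodular cs⊆𝒟) ⟩
          ∑ us h - ∑ Ls (λ e → cut (t D e cs))
            ≡⟨ cong (λ z → ∑ us h - z) (∑-cong Ls (λ e → cong cut (uncross-modular (w-modular D e) cs))) ⟨
          ∑ us h - ∑ Ls (λ e → cut (t D e us))
            ≡⟨ +-congʳ (- ∑ Ls (λ e → cut (t D e us))) ∑h ⟩
          ∑ Ls (λ e → ∑ us (ρ D e)) - ∑ us s - ∑ Ls (λ e → cut (t D e us))
            -- On a chain `chain-ρ` bounds the number of members that e enters by its coverage plus
            -- its charge, so the charges cancel and only covered edges remain.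
            ≤⟨ +-monoˡ-≤ _ (+-monoˡ-≤ _ (∑-mono Ls (λ e → chain-ρ D e (uncross-chain cs)))) ⟩
          ∑ Ls (λ e → ι (covered D e us) + cut (t D e us)) - ∑ us s - ∑ Ls (λ e → cut (t D e us))
            ≡⟨ cong (λ z → z - ∑ us s - ∑ Ls (λ e → cut (t D e us))) (∑-+ Ls _ _) ⟩
          ∑ Ls (λ e → ι (covered D e us)) + ∑ Ls (λ e → cut (t D e us)) - ∑ us s - ∑ Ls (λ e → cut (t D e us))
            ≡⟨ cancel (∑ Ls (λ e → ι (covered D e us))) _ _ ⟩
          ∑ Ls (λ e → ι (covered D e us)) - ∑ us s
            ≤⟨ +-mono-≤ (≤-reflexive (∑-cong Ls (λ e → cong ι (sym (dedup-any _ (uncross-chain cs))))))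
                        (neg-mono-≤ (dedup-∑ us (All.map s≥0 (uncross-𝒟 cs⊆𝒟)))) ⟩
          ∑ Ls (λ e → ι (covered D e chain)) - ∑ chain s
            ≡⟨ cong (λ z → z - ∑ chain s) ϱL-chain ⟩
          + ϱL D L chain - ∑ chain s ∎
          where
          open ≤-Reasoning
          us = uncross cs
          ∑h : ∑ us h ≡ ∑ Ls (λ e → ∑ us (ρ D e)) - ∑ us s
          ∑h = trans (∑-cong us h≡ρ-s) (trans (∑-minus us _ s) (cong (λ z → z - ∑ us s) (∑-swap us Ls (λ C e → ρ D e C))))
          cancel : ∀ a b c → a + b - c - b ≡ a - c
          cancel = solve-∀

        -- The choice `K` = m + 1 pays off here: 0 ≤ |Z| gives ∑ s ≤ ϱ_L ≤ m.
        ∑s<K : ∑ chain s < K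
        ∑s<K = ≤-<-trans (flip (≤-trans (+≤+ z≤n) ∣Z∣≤ϱ-s)) (ℤ.+<+ (s≤s (ℕ.≤-trans (length-filter _ all)
          (ℕ.≤-reflexive (length-tabulate id)))))
          where
          flip : ∀ {a b} → 0ℤ ≤ a - b → b ≤ a
          flip = 0≤i-j⇒j≤i

        -- Each `s` C is at most the whole sum, hence below `K`, which by `term-or-far` excludes an
        -- infinite bound at any member.
        chainSum-≡ : chainSum D f g p chain ≡ just (∑ chain s)
        chainSum-≡ = sumE-just (go chain-finite (∑-≥-member (All.map s≥0 chain-finite)))
          where
          go : ∀ {xs} → All Finite xs → All (λ C → s C ≤ ∑ chain s) xs → All (λ C → term D f g p C ≡ just (s C)) xs
          go []ₐ []ₐ = []ₐ
          go (d ∷ₐ ds) (le ∷ₐ les) with term-or-far d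
          ... | inj₁ eq  = eq ∷ₐ go ds les
          ... | inj₂ far = contradiction (≤-<-trans (≤-trans far le) ∑s<K) (<-irrefl refl)

        chainValue-≡ : chainValue D f g p L chain ≡ just (+ countUpper D g L y)
        -- All inequalities close up: count ≤ |Z| ≤ value of the chain ≤ count.
        chainValue-≡ = trans value (cong just (≤-antisym
          (weak-duality L y-flow chain _ value) (≤-trans count≤∣Z∣ ∣Z∣≤ϱ-s)))
          where
          value = chainValue-just L chain chainSum-≡

theorem3p1 : (D : Digraph) (f g : Fin (m D) → Maybe ℤ) (p : Subset (n D) → Maybe ℤ)
    (L : Subset (m D)) →
    BoundsOK D f g →
    FullySupermodular0 (n D) p →
    (∃ λ (x₀ : Fin (m D) → ℚ) → InQ D f g p x₀) →
    GoodL D f g L →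
    (Σ (Fin (m D) → ℤ) λ x → Σ (List (Subset (n D))) λ 𝒞 →
    InQℤ D f g p x × IsChain D 𝒞 × Feasible D f g p 𝒞 ×
    chainValue D f g p L 𝒞 ≡ just (+ countUpper D g L x) ×
    (∀ (x' : Fin (m D) → ℤ) → InQℤ D f g p x' →
    ∀ (𝒞' : List (Subset (n D))) (k : ℤ) → IsChain D 𝒞' →
    chainValue D f g p L 𝒞' ≡ just k → k ≤ + countUpper D g L x'))
    ×
    ((Σ (Fin (m D) → ℤ) λ x → InQℤ D f g p x × countUpper D g L x ≡ 0) →
    Σ ℤ λ k₀ → chainValue D f g p L [] ≡ just k₀ ×
    (∀ (𝒞' : List (Subset (n D))) (k : ℤ) → IsChain D 𝒞' →
    chainValue D f g p L 𝒞' ≡ just k → k ≤ k₀))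
theorem3p1 D f g p L _ (_ , p⊤ , super) nonempty goodL =
    ( y , chain , IsFlow⇒InQℤ p⊤ y-flow , isChain , (∑ chain s , chainSum-≡) , chainValue-≡
    , λ x′ q 𝒞 k _ → weak-duality L (InQℤ⇒IsFlow q) 𝒞 k)
  -- The value of the empty chain is kept in unevaluated form; that it is nonnegative suffices, as
  -- `weak-duality` at x′ bounds every other value by 0.
  , λ (x′ , q , count≡0) → + ϱL D L [] - 0ℤ , refl , λ 𝒞 k _ eq →
      ≤-trans (weak-duality L (InQℤ⇒IsFlow q) 𝒞 k eq)
              (≤-trans (≤-reflexive (cong +_ count≡0)) (i≤j⇒0≤j-i (+≤+ z≤n)))
  where
  open BaseFlow D f g p
  open Duality D f g p super
  open Lattice D Finite finite? finite-∩ finite-∪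
  x-flow = proj₂ (integral-point nonempty)
  open Strong L goodL x-flow
  cov = cover Ls h-supermodular h≤ρ
  -- The second use of `integral-flow`: the first, in `integral-point`, rounded x₀ to the flow that
  -- anchors `f₀` and `g₀`, and this one turns the cover into an optimal flow.
  optimal = integral-flow f₀ (FromCover.c' cov) p₀-supermodular (FromCover.p₀≤capacity' cov)
  y = proj₁ optimal
  open FromCover cov
  open FromFlow {y} (proj₁ (proj₂ optimal)) (proj₂ (proj₂ optimal))
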